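{- For every $\varepsilon > 0$ there exist $n_0$ and $\eta > 0$ such that the following holds for every $n \geq n_0$. If $\mathcal{H}$ is an $n$-vertex linear hypergraph with maximum degree at most $\eta n$ and with no edge $e$ satisfying $\eta\sqrt{n} < |e| < \sqrt{n}/\eta$, then $\chi'(\mathcal{H}) \leq \varepsilon n$.
   Context: A hypergraph has a finite vertex set and a set of (non-repeated) nonempty subsets of it as edges; it is linear if any two distinct edges share at most one vertex. The degree of a vertex is the number of edges containing it. $\chi'(\mathcal{H})$ is the chromatic index: the minimum number of colours in an assignment of colours to edges such that intersecting distinct edges get distinct colours. -}

module Defs where

open import Data.Nat using (ℕ)
open import Data.Integer using (+_)
open import Data.Rational using (ℚ; _/_; _*_; _≤_; _<_)
open import Data.Fin using (Fin)
open import Data.Fin.Subset using (Subset; _∈_; _∩_; Nonempty; ∣_∣)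
open import Data.Fin.Subset.Properties using (_∈?_)
open import Data.List using (length; filter; allFin)
open import Data.Product using (_×_; ∃)
open import Function.Definitions using (Injective)
open import Relation.Binary.PropositionalEquality using (_≡_; _≢_)
open import Relation.Nullary using (¬_)

ℕtoℚ : ℕ → ℚ
ℕtoℚ n = (+ n) / 1

record Hypergraph (n : ℕ) : Set where
  field
    m        : ℕ
    edge     : Fin m → Subset n
    edge-inj : Injective _≡_ _≡_ edge
    nonempty : ∀ i → Nonempty (edge i)
open Hypergraph public

Linear : ∀ {n} → Hypergraph n → Set
Linear H = ∀ i j → i ≢ j → ∣ edge H i ∩ edge H j ∣ Data.Nat.≤ 1

degree : ∀ {n} → Hypergraph n → Fin n → ℕ
degree H v = length (filter (λ i → v ∈? edge H i) (allFin (m H)))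

edgeSize : ∀ {n} (H : Hypergraph n) → Fin (m H) → ℕ
edgeSize H i = ∣ edge H i ∣

IsProperEdgeColouring : ∀ {n} (H : Hypergraph n) (k : ℕ) → (Fin (m H) → Fin k) → Set
IsProperEdgeColouring H k c =
  ∀ i j → i ≢ j → Nonempty (edge H i ∩ edge H j) → c i ≢ c j

ChromaticIndex≤ : ∀ {n} → Hypergraph n → ℚ → Set
ChromaticIndex≤ H x =
  ∃ λ k → (ℕtoℚ k ≤ x) × ∃ λ (c : Fin (m H) → Fin k) → IsProperEdgeColouring H k c

{-# OPTIONS --safe #-}
-- Edges of size at least √n/η are so few that they all get colours of their own. The remaining
-- edges are grouped by size into ranges [L^i, L^(i+1)), coloured from large to small, with one palette for even i
-- and one for odd i: an edge of group i meets at most 2n/L edges of groups i+2 and above, so few colours of its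
-- palette are lost. Within a group, the conflict graph has degree O(Ln), while two intersecting edges have at
-- most ηn + η²n common neighbours. Such a locally sparse graph is coloured from lists that are much smaller than
-- its degree by counting: for every set H of vertices and every v, the average over all proper colourings of H
-- of the number of colours available at v is linear in n. By induction on H and size bias, most neighbours of v
-- have linearly many available colours. These neighbours hardly interact, so that resampling them one at a time
-- shows that a given colour avoids all of them with probability about exp(- Σ 1/|list|), and the exponents
-- add up over all colours to at most twice the number of neighbours.
module Submission where

open import Defs

-- A greedy choice would need lists longer than the degree, which is of order `L * n`, while a
-- palette has fewer than `n` colours. The gain comes from repetition: when the neighbours of `v`
-- hardly constrain one another, most colours are missed by all of them with a probability bounded
-- below in terms of the ratio `R` of degree to list size. So the constants come in an order without
-- circle: `R` is fixed by the target number of colours, `W R` by `R`, and only then the scale `b`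
-- of local sparsity. The induction concerns averages because a single colouring may exhaust the
-- list of `v`, and because averages need neither concentration nor a local lemma: Markov's
-- inequality and size bias are enough. Resampling one neighbour of `v` would change the lists of
-- the others; therefore each is judged by a list that ignores the constraints inside the
-- neighbourhood of `v`, and sparsity makes this list comparable to the true one. Probabilities are
-- counts over all maps to the palette, scaled by `P` or its powers, and quotients are floors; each
-- floor costs a factor 2, which explains several of the numerical constants.

module Sums where
  open import Data.Nat using (ℕ; zero; suc; _+_; _*_; _∸_; _/_; _%_; _^_; _≤_; _<_; _≤?_; z≤n; s≤s; NonZero)
  open import Data.Nat.Properties hiding (_≟_)
  open import Data.Nat.DivMod using (m/n*n≤m; m≡m%n+[m/n]*n; m%n<n; m≥n⇒m/n>0)
  open import Data.Nat.Tactic.RingSolver using (solve-∀)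
  open import Data.Fin using (Fin; zero; suc)
  open import Data.Fin.Properties using (_≟_)
  open import Data.List using (List; []; _∷_; _++_; map; length; filter; tabulate; allFin; concatMap)
  open import Data.List.Properties using (length-tabulate)
  open import Data.List.Membership.Propositional using (_∈_)
  open import Data.List.Membership.Propositional.Properties using (∈-allFin)
  open import Data.List.Relation.Unary.Any using (here; there)
  open import Data.Nat.ListAction using (sum; product)
  open import Data.Vec using (Vec; []; _∷_; _[_]≔_)
  open import Data.Product using (_×_; _,_; ∃)
  open import Function using (_∘_; id)
  open import Relation.Nullary using (Dec; yes; no; ¬_; contradiction)
  open import Relation.Nullary.Decidable using (_×-dec_)
  open import Relation.Unary using (Decidable)
  open import Relation.Binary.PropositionalEquality hiding ([_])

  -- Finite sums, products and indicator functions.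

  ∑ : {A : Set} → List A → (A → ℕ) → ℕ
  ∑ xs f = sum (map f xs)

  ∏ : {A : Set} → List A → (A → ℕ) → ℕ
  ∏ xs f = product (map f xs)

  𝟙 : {P : Set} → Dec P → ℕ
  𝟙 (yes _) = 1
  𝟙 (no _)  = 0

  # : ∀ {n} {P : Fin n → Set} → Decidable P → ℕ
  # {n} P? = ∑ (allFin n) (λ i → 𝟙 (P? i))

  𝟙≤1 : {P : Set} (p? : Dec P) → 𝟙 p? ≤ 1
  𝟙≤1 (yes _) = ≤-refl
  𝟙≤1 (no _)  = z≤n

  𝟙-yes : {P : Set} (p? : Dec P) → P → 𝟙 p? ≡ 1
  𝟙-yes (yes _) _ = refl
  𝟙-yes (no ¬p) p = contradiction p ¬p

  𝟙-no : {P : Set} (p? : Dec P) → ¬ P → 𝟙 p? ≡ 0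
  𝟙-no (yes p) ¬p = contradiction p ¬p
  𝟙-no (no _)  _  = refl

  𝟙-mono : {P Q : Set} (p? : Dec P) (q? : Dec Q) → (P → Q) → 𝟙 p? ≤ 𝟙 q?
  𝟙-mono (yes p) q? f = ≤-reflexive (sym (𝟙-yes q? (f p)))
  𝟙-mono (no _)  q? f = z≤n

  𝟙-cong : {P Q : Set} (p? : Dec P) (q? : Dec Q) → (P → Q) → (Q → P) → 𝟙 p? ≡ 𝟙 q?
  𝟙-cong p? q? f g = ≤-antisym (𝟙-mono p? q? f) (𝟙-mono q? p? g)

  𝟙-× : {P Q : Set} (p? : Dec P) (q? : Dec Q) → 𝟙 (p? ×-dec q?) ≡ 𝟙 p? * 𝟙 q?
  𝟙-× (yes _) (yes _) = refl
  𝟙-× (yes _) (no _)  = refl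
  𝟙-× (no _)  _       = refl

  module _ {A : Set} where

    ∑-cong : ∀ (xs : List A) {f g : A → ℕ} → (∀ x → f x ≡ g x) → ∑ xs f ≡ ∑ xs g
    ∑-cong []       eq = refl
    ∑-cong (x ∷ xs) eq = cong₂ _+_ (eq x) (∑-cong xs eq)

    ∑-mono : ∀ (xs : List A) {f g : A → ℕ} → (∀ x → f x ≤ g x) → ∑ xs f ≤ ∑ xs g
    ∑-mono []       le = z≤n
    ∑-mono (x ∷ xs) le = +-mono-≤ (le x) (∑-mono xs le)

    ∑-+ : ∀ (xs : List A) (f g : A → ℕ) → ∑ xs (λ x → f x + g x) ≡ ∑ xs f + ∑ xs g
    ∑-+ []       f g = refl
    ∑-+ (x ∷ xs) f g = trans (cong (f x + g x +_) (∑-+ xs f g)) (interchange (f x) (g x) _ _)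
      where
      interchange : ∀ a b c d → a + b + (c + d) ≡ a + c + (b + d)
      interchange = solve-∀

    ∑-* : ∀ (xs : List A) (k : ℕ) (f : A → ℕ) → ∑ xs (λ x → k * f x) ≡ k * ∑ xs f
    ∑-* []       k f = sym (*-zeroʳ k)
    ∑-* (x ∷ xs) k f = trans (cong (k * f x +_) (∑-* xs k f)) (sym (*-distribˡ-+ k (f x) _))

    ∑-const : ∀ (xs : List A) (k : ℕ) → ∑ xs (λ _ → k) ≡ length xs * k
    ∑-const []       k = refl
    ∑-const (x ∷ xs) k = cong (k +_) (∑-const xs k)

    ∑-++ : ∀ (xs ys : List A) (f : A → ℕ) → ∑ (xs ++ ys) f ≡ ∑ xs f + ∑ ys f
    ∑-++ []       ys f = refl
    ∑-++ (x ∷ xs) ys f = trans (cong (f x +_) (∑-++ xs ys f)) (sym (+-assoc (f x) _ _))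

    ∑-member : ∀ {xs : List A} {x} (f : A → ℕ) → x ∈ xs → f x ≤ ∑ xs f
    ∑-member f (here refl) = m≤m+n _ _
    ∑-member {y ∷ xs} f (there x∈) = ≤-trans (∑-member f x∈) (m≤n+m _ (f y))

    ∑-positive : ∀ (xs : List A) (f : A → ℕ) → 0 < ∑ xs f → ∃ λ x → 0 < f x
    ∑-positive (x ∷ xs) f 0<∑ with f x in eq
    ... | zero  = ∑-positive xs f 0<∑
    ... | suc _ = x , subst (0 <_) (sym eq) (s≤s z≤n)

    ∏-cong : ∀ (xs : List A) {f g : A → ℕ} → (∀ x → f x ≡ g x) → ∏ xs f ≡ ∏ xs g
    ∏-cong []       eq = refl
    ∏-cong (x ∷ xs) eq = cong₂ _*_ (eq x) (∏-cong xs eq)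

    ∏≡0 : ∀ {xs : List A} {x} (f : A → ℕ) → x ∈ xs → f x ≡ 0 → ∏ xs f ≡ 0
    ∏≡0 {y ∷ xs} f (here refl) fx≡0 = cong (_* ∏ xs f) fx≡0
    ∏≡0 {y ∷ xs} f (there x∈) fx≡0 = trans (cong (f y *_) (∏≡0 f x∈ fx≡0)) (*-zeroʳ (f y))

    ∏-scale : ∀ (xs : List A) (k : ℕ) (f : A → ℕ) → ∏ xs (λ x → k * f x) ≡ k ^ length xs * ∏ xs f
    ∏-scale []       k f = refl
    ∏-scale (x ∷ xs) k f = trans (cong (k * f x *_) (∏-scale xs k f)) (shuffle k (f x) (k ^ length xs) (∏ xs f))
      where
      shuffle : ∀ a b c d → a * b * (c * d) ≡ a * c * (b * d)
      shuffle = solve-∀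

    ∏-𝟙≤1 : ∀ (xs : List A) {P : A → Set} (P? : Decidable P) → ∏ xs (λ x → 𝟙 (P? x)) ≤ 1
    ∏-𝟙≤1 []       P? = ≤-refl
    ∏-𝟙≤1 (x ∷ xs) P? = *-mono-≤ (𝟙≤1 (P? x)) (∏-𝟙≤1 xs P?)

    markov : ∀ (xs : List A) (f : A → ℕ) t → t * ∑ xs (λ x → 𝟙 (t ≤? f x)) ≤ ∑ xs f
    markov xs f t = begin
      t * ∑ xs (λ x → 𝟙 (t ≤? f x))   ≡⟨ ∑-* xs t _ ⟨
      ∑ xs (λ x → t * 𝟙 (t ≤? f x))   ≤⟨ ∑-mono xs (λ x → pointwise (f x)) ⟩
      ∑ xs f                          ∎
      where
      open ≤-Reasoning
      pointwise : ∀ n → t * 𝟙 (t ≤? n) ≤ n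
      pointwise n with t ≤? n
      ... | yes t≤n = ≤-trans (≤-reflexive (*-identityʳ t)) t≤n
      ... | no  _   = ≤-trans (≤-reflexive (*-zeroʳ t)) z≤n

  ∑-swap : {A B : Set} (xs : List A) (ys : List B) (f : A → B → ℕ) →
           ∑ xs (λ x → ∑ ys (f x)) ≡ ∑ ys (λ y → ∑ xs (λ x → f x y))
  ∑-swap []       ys f = sym (trans (∑-const ys 0) (*-zeroʳ (length ys)))
  ∑-swap (x ∷ xs) ys f = trans (cong (∑ ys (f x) +_) (∑-swap xs ys f)) (sym (∑-+ ys (f x) _))

  ∑-map : {A B : Set} (h : A → B) (xs : List A) (f : B → ℕ) → ∑ (map h xs) f ≡ ∑ xs (f ∘ h)
  ∑-map h []       f = refl
  ∑-map h (x ∷ xs) f = cong (f (h x) +_) (∑-map h xs f)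

  ∑-concatMap : {A B : Set} (h : A → List B) (xs : List A) (f : B → ℕ) →
                ∑ (concatMap h xs) f ≡ ∑ xs (λ x → ∑ (h x) f)
  ∑-concatMap h []       f = refl
  ∑-concatMap h (x ∷ xs) f = trans (∑-++ (h x) _ f) (cong (∑ (h x) f +_) (∑-concatMap h xs f))

  length-filter : {A : Set} {P : A → Set} (P? : Decidable P) (xs : List A) →
                  length (filter P? xs) ≡ ∑ xs (λ x → 𝟙 (P? x))
  length-filter P? []       = refl
  length-filter P? (x ∷ xs) with P? x
  ... | yes _ = cong suc (length-filter P? xs)
  ... | no  _ = length-filter P? xs

  ∑-tabulate : ∀ {n} {A : Set} (h : Fin n → A) (f : A → ℕ) → ∑ (tabulate h) f ≡ ∑ (allFin n) (f ∘ h)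
  ∑-tabulate {zero}  h f = refl
  ∑-tabulate {suc n} h f = cong (f (h zero) +_)
    (trans (∑-tabulate (h ∘ suc) f) (sym (∑-tabulate suc (f ∘ h))))

  ∑-allFin-suc : ∀ n (f : Fin (suc n) → ℕ) → ∑ (allFin (suc n)) f ≡ f zero + ∑ (allFin n) (f ∘ suc)
  ∑-allFin-suc n f = cong (f zero +_) (∑-tabulate suc f)

  ∑-allFin-const : ∀ n k → ∑ (allFin n) (λ _ → k) ≡ n * k
  ∑-allFin-const n k = trans (∑-const (allFin n) k) (cong (_* k) (length-tabulate {n = n} id))

  ∑-delta : ∀ {n} (j : Fin n) → # (j ≟_) ≡ 1
  ∑-delta {suc n} zero = trans (∑-allFin-suc n (λ i → 𝟙 (zero ≟ i))) (cong suc
    (trans (∑-cong (allFin n) (λ i → 𝟙-no (zero ≟ suc i) λ ())) (trans (∑-allFin-const n 0) (*-zeroʳ n))))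
  ∑-delta {suc n} (suc j) = trans (∑-allFin-suc n (λ i → 𝟙 (suc j ≟ i)))
    (trans (∑-cong (allFin n) (λ i → 𝟙-cong (suc j ≟ suc i) (j ≟ i) (λ { refl → refl }) (cong suc))) (∑-delta j))

  #-mono : ∀ {n} {P Q : Fin n → Set} (P? : Decidable P) (Q? : Decidable Q) → (∀ i → P i → Q i) → # P? ≤ # Q?
  #-mono {n} P? Q? P⇒Q = ∑-mono (allFin n) (λ i → 𝟙-mono (P? i) (Q? i) (P⇒Q i))

  #-cong : ∀ {n} {P Q : Fin n → Set} (P? : Decidable P) (Q? : Decidable Q) →
           (∀ i → P i → Q i) → (∀ i → Q i → P i) → # P? ≡ # Q?
  #-cong P? Q? f g = ≤-antisym (#-mono P? Q? f) (#-mono Q? P? g)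

  #≤n : ∀ {n} {P : Fin n → Set} (P? : Decidable P) → # P? ≤ n
  #≤n {n} P? = ≤-trans (∑-mono (allFin n) (λ i → 𝟙≤1 (P? i)))
                       (≤-reflexive (trans (∑-allFin-const n 1) (*-identityʳ n)))

  #-witness : ∀ {n} {P : Fin n → Set} (P? : Decidable P) {i} → P i → 1 ≤ # P?
  #-witness P? {i} p = ≤-trans (≤-reflexive (sym (𝟙-yes (P? i) p)))
                               (∑-member (λ j → 𝟙 (P? j)) (∈-allFin i))

  #-image : ∀ {n k} {P : Fin n → Set} (P? : Decidable P) (h : Fin n → Fin k) →
            ∑ (allFin k) (λ c → ∑ (allFin n) (λ i → 𝟙 (P? i) * 𝟙 (h i ≟ c))) ≡ # P?
  #-image {n} {k} P? h = begin
    ∑ (allFin k) (λ c → ∑ (allFin n) (λ i → 𝟙 (P? i) * 𝟙 (h i ≟ c)))   ≡⟨ ∑-swap (allFin k) (allFin n) _ ⟩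
    ∑ (allFin n) (λ i → ∑ (allFin k) (λ c → 𝟙 (P? i) * 𝟙 (h i ≟ c)))   ≡⟨ ∑-cong (allFin n) (λ i → ∑-* (allFin k) (𝟙 (P? i)) _) ⟩
    ∑ (allFin n) (λ i → 𝟙 (P? i) * # (h i ≟_))                          ≡⟨ ∑-cong (allFin n) (λ i → trans (cong (𝟙 (P? i) *_) (∑-delta (h i))) (*-identityʳ _)) ⟩
    # P?                                                                ∎
    where open ≡-Reasoning

  -- Sums over all maps to a palette.

  allVec : ∀ P m → List (Vec (Fin P) m)
  allVec P zero    = [] ∷ []
  allVec P (suc m) = concatMap (λ a → map (a ∷_) (allVec P m)) (allFin P)

  ∑-allVec : ∀ P m (f : Vec (Fin P) (suc m) → ℕ) →
             ∑ (allVec P (suc m)) f ≡ ∑ (allFin P) (λ a → ∑ (allVec P m) (f ∘ (a ∷_)))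
  ∑-allVec P m f = trans (∑-concatMap (λ a → map (a ∷_) (allVec P m)) (allFin P) f)
                         (∑-cong (allFin P) (λ a → ∑-map (a ∷_) (allVec P m) f))

  -- Double counting of the pairs of `σ` and `a`: a given vector arises as `σ [ u ]≔ a` from exactly
  -- `P` pairs, since `a` must be its entry at `u` while the old entry of `σ` there is arbitrary.
  -- This takes the place of conditioning on all entries except the one at `u`.
  resample : ∀ P m (u : Fin m) (f : Vec (Fin P) m → ℕ) →
             P * ∑ (allVec P m) f ≡ ∑ (allVec P m) (λ σ → ∑ (allFin P) (λ a → f (σ [ u ]≔ a)))
  resample P (suc m) zero f = begin
    P * ∑ (allVec P (suc m)) f                                              ≡⟨ cong (P *_) (∑-allVec P m f) ⟩
    P * ∑ (allFin P) (λ a → ∑ (allVec P m) (λ τ → f (a ∷ τ)))               ≡⟨ cong (P *_) (∑-swap (allFin P) (allVec P m) _) ⟩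
    P * ∑ (allVec P m) (λ τ → ∑ (allFin P) (λ a → f (a ∷ τ)))               ≡⟨ ∑-allFin-const P _ ⟨
    ∑ (allFin P) (λ _ → ∑ (allVec P m) (λ τ → ∑ (allFin P) (λ a → f (a ∷ τ)))) ≡⟨ ∑-allVec P m (λ σ → ∑ (allFin P) (λ a → f (σ [ zero ]≔ a))) ⟨
    ∑ (allVec P (suc m)) (λ σ → ∑ (allFin P) (λ a → f (σ [ zero ]≔ a)))     ∎
    where open ≡-Reasoning
  resample P (suc m) (suc u) f = begin
    P * ∑ (allVec P (suc m)) f                                     ≡⟨ cong (P *_) (∑-allVec P m f) ⟩
    P * ∑ (allFin P) (λ b → ∑ (allVec P m) (λ τ → f (b ∷ τ)))      ≡⟨ ∑-* (allFin P) P _ ⟨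
    ∑ (allFin P) (λ b → P * ∑ (allVec P m) (λ τ → f (b ∷ τ)))      ≡⟨ ∑-cong (allFin P) (λ b → resample P m u (λ τ → f (b ∷ τ))) ⟩
    ∑ (allFin P) (λ b → ∑ (allVec P m) (λ τ → ∑ (allFin P) (λ a → f (b ∷ (τ [ u ]≔ a)))))
                                                                   ≡⟨ ∑-allVec P m (λ σ → ∑ (allFin P) (λ a → f (σ [ suc u ]≔ a))) ⟨
    ∑ (allVec P (suc m)) (λ σ → ∑ (allFin P) (λ a → f (σ [ suc u ]≔ a))) ∎
    where open ≡-Reasoning

  ∑-allVec-positive : ∀ P m → 0 < P → 0 < ∑ (allVec P m) (λ _ → 1)
  ∑-allVec-positive P zero    0<P = s≤s z≤n
  ∑-allVec-positive P (suc m) 0<P = begin-strict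
    0                                                ≡⟨⟩
    0 * 0                                            <⟨ *-mono-< 0<P (∑-allVec-positive P m 0<P) ⟩
    P * ∑ (allVec P m) (λ _ → 1)                     ≡⟨ ∑-allFin-const P _ ⟨
    ∑ (allFin P) (λ _ → ∑ (allVec P m) (λ _ → 1))    ≡⟨ ∑-allVec P m (λ _ → 1) ⟨
    ∑ (allVec P (suc m)) (λ _ → 1)                   ∎
    where open ≤-Reasoning

  -- Division with junk value 0 for the divisor 0.
  _÷_ : ℕ → ℕ → ℕ
  N ÷ zero  = 0
  N ÷ suc x = N / suc x

  *-÷-≤ : ∀ N x → x * (N ÷ x) ≤ N
  *-÷-≤ N zero    = z≤n
  *-÷-≤ N (suc x) = ≤-trans (≤-reflexive (*-comm (suc x) _)) (m/n*n≤m N (suc x))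

  -- As `x ≤ N`, the quotient is at least 1, so the remainder is less than `x` times the quotient.
  -- Rounding down thus loses at most a factor 2.
  ≤-2*-÷ : ∀ {N x} → 0 < x → x ≤ N → N ≤ 2 * (x * (N ÷ x))
  ≤-2*-÷ {N} {suc y} _ x≤N = begin
    N                              ≡⟨ m≡m%n+[m/n]*n N x ⟩
    N % x + N / x * x              ≤⟨ +-monoˡ-≤ _ (<⇒≤ (m%n<n N x)) ⟩
    x + N / x * x                  ≤⟨ +-monoˡ-≤ _ (≤-trans (≤-reflexive (sym (*-identityˡ x))) (*-monoˡ-≤ x (m≥n⇒m/n>0 x≤N))) ⟩
    N / x * x + N / x * x          ≡⟨ double (N / x) x ⟩
    2 * (x * (N / x))              ∎
    where
    open ≤-Reasoning
    x = suc y
    double : ∀ a b → a * b + a * b ≡ 2 * (b * a)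
    double = solve-∀

  -- Lower bounds for products of factors close to `N`.

  cross-≤ : ∀ N r x → r + x ≤ N → N * (N ∸ (r + x)) ≤ (N ∸ r) * (N ∸ x)
  cross-≤ N r x r+x≤N with m≤n⇒∃[o]m+o≡n r+x≤N
  ... | t , refl = begin
    (r + x + t) * (r + x + t ∸ (r + x))       ≡⟨ cong ((r + x + t) *_) (m+n∸m≡n (r + x) t) ⟩
    (r + x + t) * t                           ≤⟨ m≤m+n _ (x * r) ⟩
    (r + x + t) * t + x * r                   ≡⟨ expand r x t ⟩
    (x + t) * (r + t)                         ≡⟨ cong₂ _*_ (drop-r r x t) (drop-x r x t) ⟨
    (r + x + t ∸ r) * (r + x + t ∸ x)         ∎
    where
    open ≤-Reasoning
    expand : ∀ r x t → (r + x + t) * t + x * r ≡ (x + t) * (r + t)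
    expand = solve-∀
    drop-r : ∀ r x t → r + x + t ∸ r ≡ x + t
    drop-r r x t = trans (cong (_∸ r) (+-assoc r x t)) (m+n∸m≡n r (x + t))
    drop-x : ∀ r x t → r + x + t ∸ x ≡ r + t
    drop-x r x t = trans (cong (λ z → z + t ∸ x) (+-comm r x)) (drop-r x r t)

  -- The factors are grouped greedily into blocks of sum about N/2, each of which costs a factor 1/4;
  -- j is twice the number of finished blocks, and r is the sum of the unfinished one.
  ∏-blocks : {A : Set} (N : ℕ) (f : A → ℕ) (xs : List A) → (∀ x → 4 * f x ≤ N) →
    ∃ λ j → ∃ λ r → 2 * r ≤ N × j * N + 4 * r ≤ 4 * ∑ xs f ×
      (N ∸ r) * N ^ length xs ≤ 2 ^ j * ∏ xs (λ x → N ∸ f x) * N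
  ∏-blocks N f []       f≤ = 0 , 0 , z≤n , z≤n , ≤-reflexive (*-comm N 1)
  ∏-blocks N f (x ∷ xs) f≤ with ∏-blocks N f xs f≤
  ... | j , r , 2r≤N , credit , bound = next
    where
    open ≤-Reasoning
    Π = ∏ xs (λ x → N ∸ f x)
    ℓ = N ^ length xs
    4s≤3N : 4 * (r + f x) ≤ 3 * N
    4s≤3N = begin
      4 * (r + f x)            ≡⟨ split r (f x) ⟩
      2 * (2 * r) + 4 * f x    ≤⟨ +-mono-≤ (*-monoʳ-≤ 2 2r≤N) (f≤ x) ⟩
      2 * N + N                ≡⟨ join N ⟩
      3 * N                    ∎
      where
      split : ∀ r y → 4 * (r + y) ≡ 2 * (2 * r) + 4 * y
      split = solve-∀
      join : ∀ N → 2 * N + N ≡ 3 * N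
      join = solve-∀
    s≤N : r + f x ≤ N
    s≤N = *-cancelˡ-≤ 4 (≤-trans 4s≤3N (*-monoˡ-≤ N (n≤1+n 3)))
    step : (N ∸ (r + f x)) * (N * ℓ) ≤ 2 ^ j * ((N ∸ f x) * Π) * N
    step = begin
      (N ∸ (r + f x)) * (N * ℓ)         ≡⟨ lhs (N ∸ (r + f x)) N ℓ ⟩
      N * (N ∸ (r + f x)) * ℓ           ≤⟨ *-monoˡ-≤ ℓ (cross-≤ N r (f x) s≤N) ⟩
      (N ∸ r) * (N ∸ f x) * ℓ           ≡⟨ mid (N ∸ r) (N ∸ f x) ℓ ⟩
      (N ∸ f x) * ((N ∸ r) * ℓ)         ≤⟨ *-monoʳ-≤ (N ∸ f x) bound ⟩
      (N ∸ f x) * (2 ^ j * Π * N)       ≡⟨ rhs (N ∸ f x) (2 ^ j) Π N ⟩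
      2 ^ j * ((N ∸ f x) * Π) * N       ∎
      where
      lhs : ∀ a b c → a * (b * c) ≡ b * a * c
      lhs = solve-∀
      mid : ∀ a b c → a * b * c ≡ b * (a * c)
      mid = solve-∀
      rhs : ∀ a b c d → a * (b * c * d) ≡ b * (a * c) * d
      rhs = solve-∀
    credit′ : j * N + 4 * (r + f x) ≤ 4 * (f x + ∑ xs f)
    credit′ = begin
      j * N + 4 * (r + f x)       ≡⟨ lhs (j * N) r (f x) ⟩
      4 * f x + (j * N + 4 * r)   ≤⟨ +-monoʳ-≤ (4 * f x) credit ⟩
      4 * f x + 4 * ∑ xs f        ≡⟨ *-distribˡ-+ 4 (f x) _ ⟨
      4 * (f x + ∑ xs f)          ∎
      where
      lhs : ∀ a r y → a + 4 * (r + y) ≡ 4 * y + (a + 4 * r)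
      lhs = solve-∀
    next : ∃ λ j → ∃ λ r → 2 * r ≤ N × j * N + 4 * r ≤ 4 * (f x + ∑ xs f) ×
      (N ∸ r) * (N * ℓ) ≤ 2 ^ j * ((N ∸ f x) * Π) * N
    next with 2 * (r + f x) ≤? N
    ... | yes 2s≤N = j , r + f x , 2s≤N , credit′ , step
    ... | no  2s≰N = 2 + j , 0 , z≤n , credit″ , step″
      where
      credit″ : (2 + j) * N + 4 * 0 ≤ 4 * (f x + ∑ xs f)
      credit″ = begin
        (2 + j) * N + 4 * 0              ≡⟨ lhs j N ⟩
        j * N + 2 * N                    ≤⟨ +-monoʳ-≤ (j * N) (*-monoʳ-≤ 2 (<⇒≤ (≰⇒> 2s≰N))) ⟩
        j * N + 2 * (2 * (r + f x))      ≡⟨ cong (j * N +_) (*-assoc 2 2 (r + f x)) ⟨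
        j * N + 4 * (r + f x)            ≤⟨ credit′ ⟩
        4 * (f x + ∑ xs f)               ∎
        where
        lhs : ∀ j N → (2 + j) * N + 4 * 0 ≡ j * N + 2 * N
        lhs = solve-∀
      N≤4t : N ≤ 4 * (N ∸ (r + f x))
      N≤4t = +-cancelʳ-≤ (3 * N) N _ (begin
        N + 3 * N                                     ≡⟨⟩
        4 * N                                         ≡⟨ cong (4 *_) (m∸n+n≡m s≤N) ⟨
        4 * ((N ∸ (r + f x)) + (r + f x))             ≡⟨ *-distribˡ-+ 4 (N ∸ (r + f x)) (r + f x) ⟩
        4 * (N ∸ (r + f x)) + 4 * (r + f x)           ≤⟨ +-monoʳ-≤ (4 * (N ∸ (r + f x))) 4s≤3N ⟩
        4 * (N ∸ (r + f x)) + 3 * N                   ∎)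
      step″ : N * (N * ℓ) ≤ 2 ^ (2 + j) * ((N ∸ f x) * Π) * N
      step″ = begin
        N * (N * ℓ)                           ≤⟨ *-monoˡ-≤ (N * ℓ) N≤4t ⟩
        4 * (N ∸ (r + f x)) * (N * ℓ)         ≡⟨ *-assoc 4 (N ∸ (r + f x)) (N * ℓ) ⟩
        4 * ((N ∸ (r + f x)) * (N * ℓ))       ≤⟨ *-monoʳ-≤ 4 step ⟩
        4 * (2 ^ j * ((N ∸ f x) * Π) * N)     ≡⟨ rhs (2 ^ j) ((N ∸ f x) * Π) N ⟩
        2 ^ (2 + j) * ((N ∸ f x) * Π) * N     ∎
        where
        rhs : ∀ a b c → 4 * (a * b * c) ≡ (2 * (2 * a)) * b * c
        rhs = solve-∀

  -- With y for `f x` divided by `N`, this is an integer substitute for the bound 1 - y ≥ exp(-2y)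
  -- when y is small, multiplied over all factors. The credit inequality gives `j ≤ 4 * K` for the
  -- finished blocks; the unfinished one has sum at most half of `N` and costs the additional factor
  -- 2.
  ∏-lower : {A : Set} (N K : ℕ) .{{_ : NonZero N}} (f : A → ℕ) (xs : List A) →
    (∀ x → 4 * f x ≤ N) → ∑ xs f ≤ K * N →
    N ^ length xs ≤ 2 ^ (1 + 4 * K) * ∏ xs (λ x → N ∸ f x)
  ∏-lower N K f xs f≤ ∑≤ with ∏-blocks N f xs f≤
  ... | j , r , 2r≤N , credit , bound = *-cancelˡ-≤ N (begin
    N * N ^ length xs                          ≤⟨ *-monoˡ-≤ (N ^ length xs) N≤2t ⟩
    2 * (N ∸ r) * N ^ length xs                ≡⟨ *-assoc 2 (N ∸ r) _ ⟩
    2 * ((N ∸ r) * N ^ length xs)              ≤⟨ *-monoʳ-≤ 2 bound ⟩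
    2 * (2 ^ j * Π * N)                        ≤⟨ *-monoʳ-≤ 2 (*-monoˡ-≤ N (*-monoˡ-≤ Π (^-monoʳ-≤ 2 j≤4K))) ⟩
    2 * (2 ^ (4 * K) * Π * N)                  ≡⟨ shuffle (2 ^ (4 * K)) Π N ⟩
    N * (2 ^ (1 + 4 * K) * Π)                  ∎)
    where
    open ≤-Reasoning
    Π = ∏ xs (λ x → N ∸ f x)
    shuffle : ∀ a b c → 2 * (a * b * c) ≡ c * (2 * a * b)
    shuffle = solve-∀
    N≤2t : N ≤ 2 * (N ∸ r)
    N≤2t = ≤-trans (m+n≤o⇒m≤o∸n N (≤-trans (+-monoʳ-≤ N 2r≤N) (≤-reflexive (cong (N +_) (sym (+-identityʳ N))))))
                   (≤-reflexive (sym (*-distribˡ-∸ 2 N r)))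
    j≤4K : j ≤ 4 * K
    j≤4K = *-cancelʳ-≤ j (4 * K) N (begin
      j * N               ≤⟨ m≤m+n _ (4 * r) ⟩
      j * N + 4 * r       ≤⟨ credit ⟩
      4 * ∑ xs f          ≤⟨ *-monoʳ-≤ 4 ∑≤ ⟩
      4 * (K * N)         ≡⟨ *-assoc 4 K N ⟨
      4 * K * N           ∎)

-- Colouring locally sparse graphs from lists much shorter than the degree.

module LocallySparse where
  open import Data.Nat using (ℕ; zero; suc; _+_; _*_; _∸_; _^_; _≤_; _<_; _≤?_; _<?_; z≤n; s≤s; NonZero; ≢-nonZero⁻¹)
  open import Data.Nat.Properties hiding (_≟_; _≤?_; _<?_)
  open import Data.Nat.Induction using (<-rec)
  open import Data.Nat.Tactic.RingSolver using (solve-∀)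
  open import Data.Fin using (Fin; zero; suc)
  open import Data.Fin.Properties using (_≟_; all?; ¬∀⟶∃¬)
  open import Data.Fin.Subset using (Subset; _∈_; _∉_; _-_; ∣_∣; ⊤; inside; outside)
  open import Data.Fin.Subset.Properties using (_∈?_; p─q⊆p; x∈p∧x≢y⇒x∈p-y; x∈p⇒∣p-x∣<∣p∣; ∈⊤; nonempty?)
  open import Data.List using (List; []; _∷_; length; allFin)
  open import Data.List.Properties using (length-tabulate)
  import Data.List.Membership.Propositional as L
  open import Data.List.Membership.Propositional.Properties using (∈-allFin)
  open import Data.List.Relation.Unary.Any using (here; there)
  open import Data.List.Relation.Unary.All using () renaming (lookup to All-lookup)
  open import Data.List.Relation.Unary.AllPairs using ([]; _∷_)
  open import Data.List.Relation.Unary.Unique.Propositional using (Unique)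
  open import Data.List.Relation.Unary.Unique.Propositional.Properties using (allFin⁺)
  open import Data.Vec using (Vec; []; _∷_; lookup; _[_]≔_; here; there)
  open import Data.Vec.Properties using (lookup∘update; lookup∘update′)
  open import Data.Product using (_×_; _,_; proj₁; proj₂; ∃)
  open import Function using (_∘_; id)
  open import Relation.Nullary using (Dec; yes; no; ¬_; contradiction)
  open import Relation.Nullary.Decidable using (¬?; _×-dec_; _→-dec_)
  open import Relation.Binary.PropositionalEquality hiding ([_])
  open Sums

  x∉p-x : ∀ {n} (p : Subset n) x → x ∉ p - x
  x∉p-x (inside  ∷ p) zero    ()
  x∉p-x (outside ∷ p) zero    ()
  x∉p-x (_ ∷ p)       (suc x) (there x∈) = x∉p-x p x x∈

  -- `∏-lower` with `16 * R` as its `K` loses the factor `2 ^ κ R`. This is the price of letting all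
  -- rich neighbours avoid one colour that is not heavy.
  κ : ℕ → ℕ
  κ R = 1 + 4 * (16 * R)

  -- Chosen so that the list size `W R * b` divided by `2 * 2 ^ κ R` is exactly the average
  -- `8 * R * b` promised by `Expected`.
  W : ℕ → ℕ
  W R = 8 * R * 2 ^ suc (κ R)

  module _ {m P : ℕ} .{{_ : NonZero P}}
    {Adj : Fin m → Fin m → Set} (adj? : ∀ u w → Dec (Adj u w)) (irreflexive : ∀ u → ¬ Adj u u)
    (symmetric : ∀ u w → Adj u w → Adj w u)
    {Ok : Fin m → Fin P → Set} (ok? : ∀ u c → Dec (Ok u c))
    (R b : ℕ) .{{_ : NonZero R}}
    (degree≤   : ∀ v → # (adj? v) ≤ R * (W R * b))
    (common≤   : ∀ v u → Adj v u → 2 * # (λ w → adj? v w ×-dec adj? u w) ≤ b)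
    (lists≥    : ∀ v → W R * b ≤ # (ok? v))
    (16≤b      : 16 ≤ b)
    where

    private
      q : ℕ
      q = W R * b

      Σσ : (Vec (Fin P) m → ℕ) → ℕ
      Σσ = ∑ (allVec P m)

      V : List (Fin m)
      V = allFin m

      C : List (Fin P)
      C = allFin P

    Proper : Subset m → Vec (Fin P) m → Set
    Proper H σ = ∀ u → u ∈ H → Ok u (lookup σ u) × (∀ w → w ∈ H → Adj u w → lookup σ u ≢ lookup σ w)

    abstract
      proper? : ∀ H σ → Dec (Proper H σ)
      proper? H σ = all? λ u → (u ∈? H) →-dec (ok? u (lookup σ u) ×-dec
        all? λ w → (w ∈? H) →-dec (adj? u w →-dec ¬? (lookup σ u ≟ lookup σ w)))

    Avail : Subset m → Vec (Fin P) m → Fin m → Fin P → Set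
    Avail H σ u c = Ok u c × (∀ w → w ∈ H → Adj u w → lookup σ w ≢ c)

    abstract
      avail? : ∀ H σ u c → Dec (Avail H σ u c)
      avail? H σ u c = ok? u c ×-dec all? λ w → (w ∈? H) →-dec (adj? u w →-dec ¬? (lookup σ w ≟ c))

    -- Colourings of H are counted among all maps to the palette, so that every colour outside H is free.
    pr : Subset m → Vec (Fin P) m → ℕ
    pr H σ = 𝟙 (proper? H σ)

    Z : Subset m → ℕ
    Z H = Σσ (pr H)

    -- The threshold is `8 * R` times `b` so that, by size bias, a vertex of `H` sees fewer than `b`
    -- available colours with probability at most 1 / (8R). As there are at most `R * q` neighbours,
    -- few of them are affected on average.
    Expected : Subset m → Set
    Expected H = ∀ v → 8 * R * b * Z H ≤ Σσ (λ σ → pr H σ * # (avail? H σ v))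

    module _ {H : Subset m} {u : Fin m} (u∈H : u ∈ H) (σ : Vec (Fin P) m) where

      private
        ≢u : ∀ {w} → w ∈ H - u → w ≢ u
        ≢u w∈ refl = x∉p-x H u w∈

        ∈H : ∀ {w} → w ∈ H - u → w ∈ H
        ∈H = p─q⊆p H _

        at : ∀ a {w} → w ≢ u → lookup (σ [ u ]≔ a) w ≡ lookup σ w
        at a w≢u = lookup∘update′ w≢u σ a

        proper-restrict : ∀ a → Proper H (σ [ u ]≔ a) → Proper (H - u) σ × Avail (H - u) σ u a
        proper-restrict a pf = below , subst (Ok u) (lookup∘update u σ a) (proj₁ (pf u u∈H)) , clash
          where
          below : Proper (H - u) σ
          below x x∈ = subst (Ok x) (at a (≢u x∈)) (proj₁ (pf x (∈H x∈))) ,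
            λ w w∈ xw → subst₂ _≢_ (at a (≢u x∈)) (at a (≢u w∈)) (proj₂ (pf x (∈H x∈)) w (∈H w∈) xw)
          clash : ∀ w → w ∈ H - u → Adj u w → lookup σ w ≢ a
          clash w w∈ uw = subst₂ _≢_ (at a (≢u w∈)) (lookup∘update u σ a)
            (≢-sym (proj₂ (pf u u∈H) w (∈H w∈) uw))

        proper-extend : ∀ a → Proper (H - u) σ × Avail (H - u) σ u a → Proper H (σ [ u ]≔ a)
        proper-extend a (pf , ok , clash) x x∈ with x ≟ u
        ... | yes refl = subst (Ok x) (sym (lookup∘update u σ a)) ok , other
          where
          other : ∀ w → w ∈ H → Adj u w → lookup (σ [ u ]≔ a) u ≢ lookup (σ [ u ]≔ a) w
          other w w∈ uw with w ≟ u
          ... | yes refl = contradiction uw (irreflexive u)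
          ... | no w≢u   = subst₂ _≢_ (sym (lookup∘update u σ a)) (sym (at a w≢u))
                             (≢-sym (clash w (x∈p∧x≢y⇒x∈p-y w∈ w≢u) uw))
        ... | no x≢u = subst (Ok x) (sym (at a x≢u)) (proj₁ (pf x x∈′)) , other
          where
          x∈′ = x∈p∧x≢y⇒x∈p-y x∈ x≢u
          other : ∀ w → w ∈ H → Adj x w → lookup (σ [ u ]≔ a) x ≢ lookup (σ [ u ]≔ a) w
          other w w∈ xw with w ≟ u
          ... | yes refl = subst₂ _≢_ (sym (at a x≢u)) (sym (lookup∘update u σ a)) (clash x x∈′ (symmetric x u xw))
          ... | no w≢u   = subst₂ _≢_ (sym (at a x≢u)) (sym (at a w≢u))
                             (proj₂ (pf x x∈′) w (x∈p∧x≢y⇒x∈p-y w∈ w≢u) xw)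

      -- The constraints within `H` are those within `H - u` and those at `u`, and neither kind
      -- reads the old colour of `u` once `a` is put there. Symmetry lets the availability of `a`
      -- cover both directions of each adjacency at `u`.
      pr-update : ∀ a → pr H (σ [ u ]≔ a) ≡ pr (H - u) σ * 𝟙 (avail? (H - u) σ u a)
      pr-update a = trans
        (𝟙-cong (proper? H (σ [ u ]≔ a)) (proper? (H - u) σ ×-dec avail? (H - u) σ u a) (proper-restrict a) (proper-extend a))
        (𝟙-× (proper? (H - u) σ) (avail? (H - u) σ u a))

      avail-update : ∀ a → # (avail? (H - u) (σ [ u ]≔ a) u) ≡ # (avail? (H - u) σ u)
      avail-update a = #-cong (avail? (H - u) (σ [ u ]≔ a) u) (avail? (H - u) σ u)
        (λ c (ok , f) → ok , λ w w∈ uw → subst (_≢ c) (at a (≢u w∈)) (f w w∈ uw))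
        (λ c (ok , f) → ok , λ w w∈ uw → subst (_≢ c) (sym (at a (≢u w∈))) (f w w∈ uw))

      ∑-pr-update : ∑ C (λ a → pr H (σ [ u ]≔ a)) ≡ pr (H - u) σ * # (avail? (H - u) σ u)
      ∑-pr-update = trans (∑-cong C pr-update) (∑-* C (pr (H - u) σ) _)

    -- In colourings of `H - u` the colour of `u` is free, so each of them occurs `P` times, every
    -- time with all its extensions to `u`. Hence the factor `P`.
    Z-remove : ∀ {H u} → u ∈ H → P * Z H ≡ Σσ (λ σ → pr (H - u) σ * # (avail? (H - u) σ u))
    Z-remove {H} {u} u∈H = trans (resample P m u (pr H)) (∑-cong (allVec P m) (∑-pr-update u∈H))

    -- Size bias: a colouring τ of H - u extends in as many ways as u has available colours,
    -- so few extensions come from those τ which leave u few colours.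
    few-available : ∀ {H u} → u ∈ H → Expected (H - u) →
      8 * R * Σσ (λ σ → pr H σ * 𝟙 (# (avail? (H - u) σ u) <? b)) ≤ Z H
    few-available {H} {u} u∈H expected = *-cancelˡ-≤ P (begin
      P * (8 * R * Σσ f)                                     ≡⟨ rotate P (8 * R) (Σσ f) ⟩
      8 * R * (P * Σσ f)                                     ≤⟨ *-monoʳ-≤ (8 * R) few ⟩
      8 * R * (b * Z (H - u))                                ≡⟨ *-assoc (8 * R) b _ ⟨
      8 * R * b * Z (H - u)                                  ≤⟨ expected u ⟩
      Σσ (λ σ → pr (H - u) σ * A σ)                          ≡⟨ Z-remove u∈H ⟨
      P * Z H                                                ∎)
      where
      open ≤-Reasoning
      A : Vec (Fin P) m → ℕ
      A σ = # (avail? (H - u) σ u)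
      f : Vec (Fin P) m → ℕ
      f σ = pr H σ * 𝟙 (A σ <? b)
      rotate : ∀ a b c → a * (b * c) ≡ b * (a * c)
      rotate = solve-∀
      bias : ∀ n → 𝟙 (n <? b) * n ≤ b
      bias n with n <? b
      ... | yes n<b = ≤-trans (≤-reflexive (*-identityˡ n)) (<⇒≤ n<b)
      ... | no  _   = z≤n
      one : ∀ σ → ∑ C (λ a → f (σ [ u ]≔ a)) ≤ b * pr (H - u) σ
      one σ = begin
        ∑ C (λ a → pr H (σ [ u ]≔ a) * 𝟙 (A (σ [ u ]≔ a) <? b))
          ≡⟨ ∑-cong C (λ a → trans (cong (λ n → pr H (σ [ u ]≔ a) * 𝟙 (n <? b)) (avail-update u∈H σ a)) (*-comm (pr H (σ [ u ]≔ a)) _)) ⟩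
        ∑ C (λ a → 𝟙 (A σ <? b) * pr H (σ [ u ]≔ a))       ≡⟨ ∑-* C (𝟙 (A σ <? b)) _ ⟩
        𝟙 (A σ <? b) * ∑ C (λ a → pr H (σ [ u ]≔ a))       ≡⟨ cong (𝟙 (A σ <? b) *_) (∑-pr-update u∈H σ) ⟩
        𝟙 (A σ <? b) * (pr (H - u) σ * A σ)                ≡⟨ shuffle (𝟙 (A σ <? b)) (pr (H - u) σ) (A σ) ⟩
        𝟙 (A σ <? b) * A σ * pr (H - u) σ                  ≤⟨ *-monoˡ-≤ (pr (H - u) σ) (bias (A σ)) ⟩
        b * pr (H - u) σ                                   ∎
        where
        shuffle : ∀ a b c → a * (b * c) ≡ a * c * b
        shuffle = solve-∀
      few : P * Σσ f ≤ b * Z (H - u)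
      few = begin
        P * Σσ f                                    ≡⟨ resample P m u f ⟩
        Σσ (λ σ → ∑ C (λ a → f (σ [ u ]≔ a)))       ≤⟨ ∑-mono (allVec P m) one ⟩
        Σσ (λ σ → b * pr (H - u) σ)                 ≡⟨ ∑-* (allVec P m) b _ ⟩
        b * Z (H - u)                               ∎

    -- The inductive step: resampling the neighbours of a vertex `v`.

    module Step (H : Subset m) (v : Fin m) (expected : ∀ u → u ∈ H → Expected (H - u)) where

      S : Fin m → Set
      S u = u ∈ H × Adj v u

      abstract
        s? : ∀ u → Dec (S u)
        s? u = (u ∈? H) ×-dec adj? v u

      -- Constraints from neighbours of `v` are left out on purpose: the list then does not change
      -- when vertices of `S` are recoloured, so that the sets of rich and poor vertices and the
      -- bounds `p` stay fixed throughout the resampling.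
      Out : Vec (Fin P) m → Fin m → Fin P → Set
      Out σ u c = Ok u c × (∀ w → w ∈ H → ¬ Adj v w → Adj u w → lookup σ w ≢ c)

      abstract
        out? : ∀ σ u c → Dec (Out σ u c)
        out? σ u c = ok? u c ×-dec all? λ w → (w ∈? H) →-dec (¬? (adj? v w) →-dec (adj? u w →-dec ¬? (lookup σ w ≟ c)))

      ℓ : Vec (Fin P) m → Fin m → ℕ
      ℓ σ u = # (out? σ u)

      Rich : Vec (Fin P) m → Fin m → Set
      Rich σ u = S u × b ≤ ℓ σ u

      abstract
        rich? : ∀ σ u → Dec (Rich σ u)
        rich? σ u = s? u ×-dec (b ≤? ℓ σ u)

      Poor : Vec (Fin P) m → Fin m → Set
      Poor σ u = S u × ℓ σ u < b

      abstract
        poor? : ∀ σ u → Dec (Poor σ u)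
        poor? σ u = s? u ×-dec (ℓ σ u <? b)

      module _ {x : Fin m} (Sx : S x) (σ : Vec (Fin P) m) (a : Fin P) where

        private
          at : ∀ {w} → ¬ Adj v w → lookup (σ [ x ]≔ a) w ≡ lookup σ w
          at ¬vw = lookup∘update′ (λ { refl → ¬vw (proj₂ Sx) }) σ a

        out→ : ∀ u c → Out (σ [ x ]≔ a) u c → Out σ u c
        out→ u c (ok , f) = ok , λ w w∈ ¬vw uw → subst (_≢ c) (at ¬vw) (f w w∈ ¬vw uw)

        out← : ∀ u c → Out σ u c → Out (σ [ x ]≔ a) u c
        out← u c (ok , f) = ok , λ w w∈ ¬vw uw → subst (_≢ c) (sym (at ¬vw)) (f w w∈ ¬vw uw)

        ℓ-update : ∀ u → ℓ (σ [ x ]≔ a) u ≡ ℓ σ u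
        ℓ-update u = #-cong (out? (σ [ x ]≔ a) u) (out? σ u) (out→ u) (out← u)

        rich→ : ∀ u → Rich (σ [ x ]≔ a) u → Rich σ u
        rich→ u (Su , b≤) = Su , subst (b ≤_) (ℓ-update u) b≤

        rich← : ∀ u → Rich σ u → Rich (σ [ x ]≔ a) u
        rich← u (Su , b≤) = Su , subst (b ≤_) (sym (ℓ-update u)) b≤

        poor→ : ∀ u → Poor (σ [ x ]≔ a) u → Poor σ u
        poor→ u (Su , <b) = Su , subst (_< b) (ℓ-update u) <b

        poor← : ∀ u → Poor σ u → Poor (σ [ x ]≔ a) u
        poor← u (Su , <b) = Su , subst (_< b) (sym (ℓ-update u)) <b

      poor⇒few-available : ∀ σ u → Poor σ u → # (avail? (H - u) σ u) < b
      poor⇒few-available σ u (_ , ℓ<b) = ≤-<-trans (#-mono (avail? (H - u) σ u) (out? σ u) incl) ℓ<b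
        where
        incl : ∀ c → Avail (H - u) σ u c → Out σ u c
        incl c (ok , f) = ok , λ w w∈ _ uw → f w (x∈p∧x≢y⇒x∈p-y w∈ (λ { refl → irreflexive u uw })) uw

      -- The outer list of `u` contains all colours available at `u` with respect to `H - u`, so a
      -- poor `u` is caught by `few-available`, an event of probability at most 1 / (8R). Over at
      -- most `R * q` neighbours this adds up to q/8.
      ∑-poor≤ : 8 * Σσ (λ σ → pr H σ * # (poor? σ)) ≤ q * Z H
      ∑-poor≤ = *-cancelˡ-≤ R (begin
        R * (8 * Σσ (λ σ → pr H σ * # (poor? σ)))
          ≡⟨ rotate R (Σσ (λ σ → pr H σ * # (poor? σ))) ⟩
        8 * R * Σσ (λ σ → pr H σ * # (poor? σ))
          ≡⟨ cong (8 * R *_) (∑-cong (allVec P m) (λ σ → sym (∑-* V (pr H σ) _))) ⟩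
        8 * R * Σσ (λ σ → ∑ V (λ u → pr H σ * 𝟙 (poor? σ u)))
          ≡⟨ cong (8 * R *_) (∑-swap (allVec P m) V _) ⟩
        8 * R * ∑ V (λ u → Σσ (λ σ → pr H σ * 𝟙 (poor? σ u)))
          ≡⟨ ∑-* V (8 * R) _ ⟨
        ∑ V (λ u → 8 * R * Σσ (λ σ → pr H σ * 𝟙 (poor? σ u)))
          ≤⟨ ∑-mono V one ⟩
        ∑ V (λ u → Z H * 𝟙 (adj? v u))
          ≡⟨ ∑-* V (Z H) _ ⟩
        Z H * # (adj? v)
          ≤⟨ *-monoʳ-≤ (Z H) (degree≤ v) ⟩
        Z H * (R * q)
          ≡⟨ rotate′ (Z H) R q ⟩
        R * (q * Z H) ∎)
        where
        open ≤-Reasoning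
        rotate : ∀ a c → a * (8 * c) ≡ 8 * a * c
        rotate = solve-∀
        rotate′ : ∀ a b c → a * (b * c) ≡ b * (c * a)
        rotate′ = solve-∀
        one : ∀ u → 8 * R * Σσ (λ σ → pr H σ * 𝟙 (poor? σ u)) ≤ Z H * 𝟙 (adj? v u)
        one u with s? u
        ... | yes Su@(u∈H , vu) = begin
          8 * R * Σσ (λ σ → pr H σ * 𝟙 (poor? σ u))
            ≤⟨ *-monoʳ-≤ (8 * R) (∑-mono (allVec P m) (λ σ → *-monoʳ-≤ (pr H σ)
                 (𝟙-mono (poor? σ u) (# (avail? (H - u) σ u) <? b) (poor⇒few-available σ u)))) ⟩
          8 * R * Σσ (λ σ → pr H σ * 𝟙 (# (avail? (H - u) σ u) <? b))
            ≤⟨ few-available u∈H (expected u u∈H) ⟩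
          Z H                  ≡⟨ *-identityʳ (Z H) ⟨
          Z H * 1              ≡⟨ cong (Z H *_) (𝟙-yes (adj? v u) vu) ⟨
          Z H * 𝟙 (adj? v u)   ∎
        ... | no ¬Su = begin
          8 * R * Σσ (λ σ → pr H σ * 𝟙 (poor? σ u))
            ≡⟨ cong (8 * R *_) (∑-cong (allVec P m) (λ σ → trans (cong (pr H σ *_) (𝟙-no (poor? σ u) (¬Su ∘ proj₁))) (*-comm (pr H σ) 0))) ⟩
          8 * R * Σσ (λ σ → 0)
            ≡⟨ cong (8 * R *_) (trans (∑-const (allVec P m) 0) (*-zeroʳ (length (allVec P m)))) ⟩
          8 * R * 0                   ≡⟨ *-zeroʳ (8 * R) ⟩
          0                           ≤⟨ z≤n ⟩
          Z H * 𝟙 (adj? v u)          ∎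

      -- A rich vertex takes a colour c of its outer list with probability at most p σ u c / P,
      -- whatever the other vertices do.
      p : Vec (Fin P) m → Fin m → Fin P → ℕ
      p σ u c = 𝟙 (rich? σ u) * (𝟙 (out? σ u c) * (4 * (P ÷ ℓ σ u)))

      ℓ≤2avail : ∀ {σ x} → Rich σ x → ℓ σ x ≤ 2 * # (avail? (H - x) σ x)
      ℓ≤2avail {σ} {x} ((x∈H , vx) , b≤ℓ) = +-cancelʳ-≤ (ℓ σ x) _ _ (begin
        ℓ σ x + ℓ σ x               ≡⟨ cong (ℓ σ x +_) (+-identityʳ _) ⟨
        2 * ℓ σ x                   ≤⟨ *-monoʳ-≤ 2 lost ⟩
        2 * (A + # common?)         ≡⟨ *-distribˡ-+ 2 A _ ⟩
        2 * A + 2 * # common?       ≤⟨ +-monoʳ-≤ (2 * A) (≤-trans (common≤ v x vx) b≤ℓ) ⟩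
        2 * A + ℓ σ x               ∎)
        where
        open ≤-Reasoning
        A = # (avail? (H - x) σ x)
        common? = λ w → adj? v w ×-dec adj? x w
        pointwise : ∀ c → 𝟙 (out? σ x c) ≤ 𝟙 (avail? (H - x) σ x c) + ∑ V (λ w → 𝟙 (common? w) * 𝟙 (lookup σ w ≟ c))
        pointwise c with out? σ x c
        ... | no _ = z≤n
        ... | yes (ok , f) with all? (λ w → (w ∈? H - x) →-dec (adj? x w →-dec ¬? (lookup σ w ≟ c)))
        ... | yes g = ≤-trans (≤-reflexive (sym (𝟙-yes (avail? (H - x) σ x c) (ok , g)))) (m≤m+n _ _)
        ... | no ¬g with ¬∀⟶∃¬ m _ (λ w → (w ∈? H - x) →-dec (adj? x w →-dec ¬? (lookup σ w ≟ c))) ¬g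
        ... | w , ¬h = ≤-trans blocked (m≤n+m _ _)
          where
          w∈ : w ∈ H - x
          w∈ with w ∈? H - x
          ... | yes w∈ = w∈
          ... | no w∉ = contradiction (λ w∈ → contradiction w∈ w∉) ¬h
          xw : Adj x w
          xw with adj? x w
          ... | yes xw = xw
          ... | no ¬xw = contradiction (λ _ xw → contradiction xw ¬xw) ¬h
          w↦c : lookup σ w ≡ c
          w↦c with lookup σ w ≟ c
          ... | yes eq = eq
          ... | no neq = contradiction (λ _ _ → neq) ¬h
          vw : Adj v w
          vw with adj? v w
          ... | yes vw = vw
          ... | no ¬vw = contradiction w↦c (f w (p─q⊆p H _ w∈) ¬vw xw)
          blocked : 1 ≤ ∑ V (λ w → 𝟙 (common? w) * 𝟙 (lookup σ w ≟ c))
          blocked = ≤-trans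
            (≤-reflexive (sym (cong₂ _*_ (𝟙-yes (common? w) (vw , xw)) (𝟙-yes (lookup σ w ≟ c) w↦c))))
            (∑-member (λ w → 𝟙 (common? w) * 𝟙 (lookup σ w ≟ c)) (∈-allFin w))
        lost : ℓ σ x ≤ A + # common?
        lost = begin
          ℓ σ x
            ≤⟨ ∑-mono C pointwise ⟩
          ∑ C (λ c → 𝟙 (avail? (H - x) σ x c) + ∑ V (λ w → 𝟙 (common? w) * 𝟙 (lookup σ w ≟ c)))
            ≡⟨ ∑-+ C _ _ ⟩
          A + ∑ C (λ c → ∑ V (λ w → 𝟙 (common? w) * 𝟙 (lookup σ w ≟ c)))
            ≡⟨ cong (A +_) (#-image common? (lookup σ)) ⟩
          A + # common? ∎

      ℓ-positive : ∀ {σ u} → Rich σ u → 0 < ℓ σ u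
      ℓ-positive (_ , b≤ℓ) = ≤-trans (s≤s z≤n) (≤-trans 16≤b b≤ℓ)

      -- The smallness hypothesis of `∏-lower`. A rich vertex has at least 16 colours in its outer
      -- list, which outweigh the 4 inside `p` times the 4 demanded here.
      p-small : ∀ σ c u → 4 * p σ u c ≤ P
      p-small σ c u with rich? σ u
      ... | no _ = z≤n
      ... | yes rich with out? σ u c
      ... | no _ = z≤n
      ... | yes _ = begin
        4 * (1 * (1 * (4 * (P ÷ ℓ σ u))))     ≡⟨ sixteen (P ÷ ℓ σ u) ⟩
        16 * (P ÷ ℓ σ u)                      ≤⟨ *-monoˡ-≤ _ (≤-trans 16≤b (proj₂ rich)) ⟩
        ℓ σ u * (P ÷ ℓ σ u)                   ≤⟨ *-÷-≤ P (ℓ σ u) ⟩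
        P                                     ∎
        where
        open ≤-Reasoning
        sixteen : ∀ a → 4 * (1 * (1 * (4 * a))) ≡ 16 * a
        sixteen = solve-∀

      -- Summed over its outer list, a rich vertex contributes at most `4 * P`, however long that
      -- list is. So the exponents of all colours together are controlled by the degree of `v`
      -- alone.
      ∑∑p≤ : ∀ σ → ∑ C (λ c → ∑ V (λ u → p σ u c)) ≤ 4 * P * (R * q)
      ∑∑p≤ σ = begin
        ∑ C (λ c → ∑ V (λ u → p σ u c))       ≡⟨ ∑-swap C V _ ⟩
        ∑ V (λ u → ∑ C (λ c → p σ u c))       ≤⟨ ∑-mono V one ⟩
        ∑ V (λ u → 4 * P * 𝟙 (adj? v u))      ≡⟨ ∑-* V (4 * P) _ ⟩
        4 * P * # (adj? v)                    ≤⟨ *-monoʳ-≤ (4 * P) (degree≤ v) ⟩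
        4 * P * (R * q)                       ∎
        where
        open ≤-Reasoning
        one : ∀ u → ∑ C (λ c → p σ u c) ≤ 4 * P * 𝟙 (adj? v u)
        one u = begin
          ∑ C (λ c → p σ u c)
            ≡⟨ ∑-* C (𝟙 (rich? σ u)) _ ⟩
          𝟙 (rich? σ u) * ∑ C (λ c → 𝟙 (out? σ u c) * (4 * (P ÷ ℓ σ u)))
            ≡⟨ cong (𝟙 (rich? σ u) *_) (∑-cong C (λ c → *-comm (𝟙 (out? σ u c)) _)) ⟩
          𝟙 (rich? σ u) * ∑ C (λ c → 4 * (P ÷ ℓ σ u) * 𝟙 (out? σ u c))
            ≡⟨ cong (𝟙 (rich? σ u) *_) (∑-* C (4 * (P ÷ ℓ σ u)) _) ⟩
          𝟙 (rich? σ u) * (4 * (P ÷ ℓ σ u) * ℓ σ u)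
            ≡⟨ cong (𝟙 (rich? σ u) *_) (shuffle (P ÷ ℓ σ u) (ℓ σ u)) ⟩
          𝟙 (rich? σ u) * (4 * (ℓ σ u * (P ÷ ℓ σ u)))
            ≤⟨ *-mono-≤ (𝟙-mono (rich? σ u) (adj? v u) (proj₂ ∘ proj₁)) (*-monoʳ-≤ 4 (*-÷-≤ P (ℓ σ u))) ⟩
          𝟙 (adj? v u) * (4 * P)
            ≡⟨ *-comm (𝟙 (adj? v u)) (4 * P) ⟩
          4 * P * 𝟙 (adj? v u) ∎
          where
          shuffle : ∀ a l → 4 * a * l ≡ 4 * (l * a)
          shuffle = solve-∀

      -- Given the other colours, `x` is uniform on its `A` available ones, so it takes `c` with
      -- probability 1/A or 0. The 4 in `p` is what makes P/A at most `p`: one factor 2 comes from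
      -- `ℓ≤2avail` and another from rounding in `P ÷ ℓ σ x`.
      resample-rich : ∀ {σ x} c → Rich σ x →
        (P ∸ p σ x c) * ∑ C (λ a → pr H (σ [ x ]≔ a)) ≤
        P * ∑ C (λ a → pr H (σ [ x ]≔ a) * 𝟙 (¬? (a ≟ c)))
      resample-rich {σ} {x} c rich@((x∈H , _) , _) = begin
        (P ∸ p σ x c) * ∑ C (λ a → pr H (σ [ x ]≔ a))
          ≡⟨ cong ((P ∸ p σ x c) *_) (∑-pr-update x∈H σ) ⟩
        (P ∸ p σ x c) * (pr (H - x) σ * A)
          ≡⟨ rotate (P ∸ p σ x c) (pr (H - x) σ) A ⟩
        pr (H - x) σ * ((P ∸ p σ x c) * A)
          ≤⟨ *-monoʳ-≤ (pr (H - x) σ) main ⟩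
        pr (H - x) σ * (P * D)
          ≡⟨ rotate (pr (H - x) σ) P D ⟩
        P * (pr (H - x) σ * D)
          ≡⟨ cong (P *_) (∑-* C (pr (H - x) σ) _) ⟨
        P * ∑ C (λ a → pr (H - x) σ * (𝟙 (avail? (H - x) σ x a) * 𝟙 (¬? (a ≟ c))))
          ≡⟨ cong (P *_) (∑-cong C (λ a → trans (sym (*-assoc (pr (H - x) σ) _ _)) (cong (_* 𝟙 (¬? (a ≟ c))) (sym (pr-update x∈H σ a))))) ⟩
        P * ∑ C (λ a → pr H (σ [ x ]≔ a) * 𝟙 (¬? (a ≟ c))) ∎
        where
        open ≤-Reasoning
        rotate : ∀ a b c → a * (b * c) ≡ b * (a * c)
        rotate = solve-∀
        A = # (avail? (H - x) σ x)
        D = ∑ C (λ a → 𝟙 (avail? (H - x) σ x a) * 𝟙 (¬? (a ≟ c)))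
        avail⇒out : Avail (H - x) σ x c → Out σ x c
        avail⇒out (ok , f) = ok , λ w w∈ _ xw → f w (x∈p∧x≢y⇒x∈p-y w∈ (λ { refl → irreflexive x xw })) xw
        A≤ : A ≤ D + 𝟙 (avail? (H - x) σ x c)
        A≤ = begin
          A
            ≤⟨ ∑-mono C split ⟩
          ∑ C (λ a → 𝟙 (avail? (H - x) σ x a) * 𝟙 (¬? (a ≟ c)) + 𝟙 (avail? (H - x) σ x c) * 𝟙 (c ≟ a))
            ≡⟨ ∑-+ C _ _ ⟩
          D + ∑ C (λ a → 𝟙 (avail? (H - x) σ x c) * 𝟙 (c ≟ a))
            ≡⟨ cong (D +_) (trans (∑-* C (𝟙 (avail? (H - x) σ x c)) _) (trans (cong (𝟙 (avail? (H - x) σ x c) *_) (∑-delta c)) (*-identityʳ _))) ⟩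
          D + 𝟙 (avail? (H - x) σ x c) ∎
          where
          split : ∀ a → 𝟙 (avail? (H - x) σ x a) ≤
            𝟙 (avail? (H - x) σ x a) * 𝟙 (¬? (a ≟ c)) + 𝟙 (avail? (H - x) σ x c) * 𝟙 (c ≟ a)
          split a with a ≟ c
          ... | yes refl = ≤-trans (≤-reflexive (sym (trans (cong (𝟙 (avail? (H - x) σ x c) *_) (𝟙-yes (c ≟ c) refl)) (*-identityʳ _)))) (m≤n+m _ _)
          ... | no _ = ≤-trans (≤-reflexive (sym (*-identityʳ _))) (m≤m+n _ _)
        main : (P ∸ p σ x c) * A ≤ P * D
        main with avail? (H - x) σ x c | A≤
        ... | no _ | A≤D = *-mono-≤ (m∸n≤m P (p σ x c)) (≤-trans A≤D (≤-reflexive (+-identityʳ D)))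
        ... | yes av | A≤D+1 = begin
          (P ∸ p σ x c) * A             ≡⟨ *-distribʳ-∸ A P (p σ x c) ⟩
          P * A ∸ p σ x c * A           ≤⟨ ∸-mono (*-monoʳ-≤ P A≤D+1) P≤pA ⟩
          P * (D + 1) ∸ P               ≡⟨ cong (_∸ P) (trans (*-distribˡ-+ P D 1) (cong (P * D +_) (*-identityʳ P))) ⟩
          P * D + P ∸ P                 ≡⟨ m+n∸n≡m (P * D) P ⟩
          P * D                         ∎
          where
          P≤pA : P ≤ p σ x c * A
          P≤pA = begin
            P                                     ≤⟨ ≤-2*-÷ (ℓ-positive rich) (#≤n (out? σ x)) ⟩
            2 * (ℓ σ x * (P ÷ ℓ σ x))             ≤⟨ *-monoʳ-≤ 2 (*-monoˡ-≤ _ (ℓ≤2avail rich)) ⟩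
            2 * (2 * A * (P ÷ ℓ σ x))             ≡⟨ shuffle A (P ÷ ℓ σ x) ⟩
            1 * (1 * (4 * (P ÷ ℓ σ x))) * A       ≡⟨ cong₂ (λ i j → i * (j * (4 * (P ÷ ℓ σ x))) * A) (𝟙-yes (rich? σ x) rich) (𝟙-yes (out? σ x c) (avail⇒out av)) ⟨
            p σ x c * A                           ∎
            where
            shuffle : ∀ a r → 2 * (2 * a * r) ≡ 1 * (1 * (4 * r)) * a
            shuffle = solve-∀

      -- An implication, so that it holds vacuously at poor vertices and outside `S`, and products
      -- over it can range over all vertices.
      RichAvoids : Vec (Fin P) m → Fin P → Fin m → Set
      RichAvoids σ c u = Rich σ u → lookup σ u ≢ c

      PoorAvoid : Vec (Fin P) m → Fin P → Set
      PoorAvoid σ c = ∀ u → Poor σ u → lookup σ u ≢ c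

      abstract
        richAvoids? : ∀ σ c u → Dec (RichAvoids σ c u)
        richAvoids? σ c u = rich? σ u →-dec ¬? (lookup σ u ≟ c)

        poorAvoid? : ∀ σ c → Dec (PoorAvoid σ c)
        poorAvoid? σ c = all? λ u → poor? σ u →-dec ¬? (lookup σ u ≟ c)

      p-update : ∀ {x} → S x → ∀ σ a u c → p (σ [ x ]≔ a) u c ≡ p σ u c
      p-update Sx σ a u c = cong₂ _*_
        (𝟙-cong (rich? (σ [ _ ]≔ a) u) (rich? σ u) (rich→ Sx σ a u) (rich← Sx σ a u))
        (cong₂ _*_ (𝟙-cong (out? (σ [ _ ]≔ a) u c) (out? σ u c) (out→ Sx σ a u c) (out← Sx σ a u c))
                   (cong (λ l → 4 * (P ÷ l)) (ℓ-update Sx σ a u)))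

      p-poor : ∀ {σ u} c → ¬ Rich σ u → p σ u c ≡ 0
      p-poor {σ} {u} c ¬rich = cong (_* (𝟙 (out? σ u c) * (4 * (P ÷ ℓ σ u)))) (𝟙-no (rich? σ u) ¬rich)

      -- Invariance is asked at rich `x` only: avoidance by the poor vertices does depend on the
      -- colour of a poor `x`. Recolouring `x` does not alter whether `x` is rich.
      InvariantAt : Fin m → (Vec (Fin P) m → ℕ) → Set
      InvariantAt x F = ∀ σ a → Rich σ x → F (σ [ x ]≔ a) ≡ F σ

      -- Where `x` is not rich, both sides agree term by term, as `p` vanishes and `RichAvoids` is
      -- vacuous. Where it is rich, `Y` and `p` are constant while `x` is resampled, and
      -- `resample-rich` applies.
      resample-one : ∀ c x (Y : Vec (Fin P) m → ℕ) → InvariantAt x Y →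
        Σσ (λ σ → pr H σ * ((P ∸ p σ x c) * Y σ)) ≤ Σσ (λ σ → pr H σ * (P * 𝟙 (richAvoids? σ c x) * Y σ))
      resample-one c x Y inv = *-cancelˡ-≤ P (begin
        P * Σσ f                                     ≡⟨ resample P m x f ⟩
        Σσ (λ σ → ∑ C (λ a → f (σ [ x ]≔ a)))        ≤⟨ ∑-mono (allVec P m) one ⟩
        Σσ (λ σ → ∑ C (λ a → g (σ [ x ]≔ a)))        ≡⟨ resample P m x g ⟨
        P * Σσ g                                     ∎)
        where
        open ≤-Reasoning
        f g : Vec (Fin P) m → ℕ
        f σ = pr H σ * ((P ∸ p σ x c) * Y σ)
        g σ = pr H σ * (P * 𝟙 (richAvoids? σ c x) * Y σ)
        equal : ∀ σ → ¬ Rich σ x → f σ ≡ g σ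
        equal σ ¬rich = cong (λ k → pr H σ * (k * Y σ)) (trans (cong (P ∸_) (p-poor c ¬rich))
          (sym (trans (cong (P *_) (𝟙-yes (richAvoids? σ c x) (λ rich → contradiction rich ¬rich))) (*-identityʳ P))))
        one : ∀ σ → ∑ C (λ a → f (σ [ x ]≔ a)) ≤ ∑ C (λ a → g (σ [ x ]≔ a))
        one σ with s? x
        ... | no ¬Sx = ≤-reflexive (∑-cong C (λ a → equal (σ [ x ]≔ a) (¬Sx ∘ proj₁)))
        ... | yes Sx with rich? σ x
        ... | no ¬rich = ≤-reflexive (∑-cong C (λ a → equal (σ [ x ]≔ a) (¬rich ∘ rich→ Sx σ a x)))
        ... | yes rich = begin
          ∑ C (λ a → f (σ [ x ]≔ a))
            ≡⟨ ∑-cong C (λ a → trans (cong₂ (λ i j → pr H (σ [ x ]≔ a) * ((P ∸ i) * j)) (p-update Sx σ a x c) (inv σ a rich))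
                                     (shuffle (pr H (σ [ x ]≔ a)) (P ∸ p σ x c) (Y σ))) ⟩
          ∑ C (λ a → Y σ * (P ∸ p σ x c) * pr H (σ [ x ]≔ a))
            ≡⟨ trans (∑-* C (Y σ * (P ∸ p σ x c)) _) (*-assoc (Y σ) (P ∸ p σ x c) _) ⟩
          Y σ * ((P ∸ p σ x c) * ∑ C (λ a → pr H (σ [ x ]≔ a)))
            ≤⟨ *-monoʳ-≤ (Y σ) (resample-rich c rich) ⟩
          Y σ * (P * ∑ C (λ a → pr H (σ [ x ]≔ a) * 𝟙 (¬? (a ≟ c))))
            ≡⟨ trans (∑-* C (Y σ * P) _) (*-assoc (Y σ) P _) ⟨
          ∑ C (λ a → Y σ * P * (pr H (σ [ x ]≔ a) * 𝟙 (¬? (a ≟ c))))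
            ≤⟨ ∑-mono C (λ a → ≤-trans (*-monoʳ-≤ (Y σ * P) (*-monoʳ-≤ (pr H (σ [ x ]≔ a)) (differs a)))
                 (≤-reflexive (trans (shuffle′ (Y σ) P (pr H (σ [ x ]≔ a)) _)
                   (cong (λ y → pr H (σ [ x ]≔ a) * (P * 𝟙 (richAvoids? (σ [ x ]≔ a) c x) * y)) (sym (inv σ a rich)))))) ⟩
          ∑ C (λ a → g (σ [ x ]≔ a)) ∎
          where
          shuffle : ∀ a b c → a * (b * c) ≡ c * b * a
          shuffle = solve-∀
          shuffle′ : ∀ a b c d → a * b * (c * d) ≡ c * (b * d * a)
          shuffle′ = solve-∀
          differs : ∀ a → 𝟙 (¬? (a ≟ c)) ≤ 𝟙 (richAvoids? (σ [ x ]≔ a) c x)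
          differs a = 𝟙-mono (¬? (a ≟ c)) (richAvoids? (σ [ x ]≔ a) c x)
            (λ a≢c _ → subst (_≢ c) (sym (lookup∘update x σ a)) a≢c)

      -- The vertices of S are resampled one at a time, the others being kept.
      resample-all : ∀ c xs → Unique xs → (F : Vec (Fin P) m → ℕ) → (∀ x → x L.∈ xs → InvariantAt x F) →
        Σσ (λ σ → pr H σ * (F σ * ∏ xs (λ x → P ∸ p σ x c))) ≤
        Σσ (λ σ → pr H σ * (F σ * ∏ xs (λ x → P * 𝟙 (richAvoids? σ c x))))
      resample-all c [] _ F inv = ≤-refl
      resample-all c (x ∷ xs) (x∉ ∷ uniq) F inv = begin
        Σσ (λ σ → pr H σ * (F σ * ((P ∸ p σ x c) * Φ σ)))
          ≡⟨ ∑-cong (allVec P m) (λ σ → cong (pr H σ *_) (rotate (F σ) (P ∸ p σ x c) (Φ σ))) ⟩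
        Σσ (λ σ → pr H σ * ((P ∸ p σ x c) * (F σ * Φ σ)))
          ≤⟨ resample-one c x (λ σ → F σ * Φ σ) inv-FΦ ⟩
        Σσ (λ σ → pr H σ * (ψ σ * (F σ * Φ σ)))
          ≡⟨ ∑-cong (allVec P m) (λ σ → cong (pr H σ *_) (rotate′ (ψ σ) (F σ) (Φ σ))) ⟩
        Σσ (λ σ → pr H σ * (F σ * ψ σ * Φ σ))
          ≤⟨ resample-all c xs uniq (λ σ → F σ * ψ σ) inv-Fψ ⟩
        Σσ (λ σ → pr H σ * (F σ * ψ σ * ∏ xs (λ x → P * 𝟙 (richAvoids? σ c x))))
          ≡⟨ ∑-cong (allVec P m) (λ σ → cong (pr H σ *_) (*-assoc (F σ) (ψ σ) _)) ⟩
        Σσ (λ σ → pr H σ * (F σ * (ψ σ * ∏ xs (λ x → P * 𝟙 (richAvoids? σ c x))))) ∎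
        where
        open ≤-Reasoning
        Φ ψ : Vec (Fin P) m → ℕ
        Φ σ = ∏ xs (λ y → P ∸ p σ y c)
        ψ σ = P * 𝟙 (richAvoids? σ c x)
        rotate : ∀ a b c → a * (b * c) ≡ b * (a * c)
        rotate = solve-∀
        rotate′ : ∀ a b c → a * (b * c) ≡ b * a * c
        rotate′ = solve-∀
        inv-FΦ : InvariantAt x (λ σ → F σ * Φ σ)
        inv-FΦ σ a rich = cong₂ _*_ (inv x (here refl) σ a rich)
          (∏-cong xs (λ y → cong (P ∸_) (p-update (proj₁ rich) σ a y c)))
        -- A vertex already treated contributes an indicator that reads its own colour and its outer
        -- list. Resampling a different vertex of `S` affects neither, and `Unique` guarantees that
        -- the later vertices are different.
        inv-Fψ : ∀ y → y L.∈ xs → InvariantAt y (λ σ → F σ * ψ σ)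
        inv-Fψ y y∈ σ a rich = cong₂ _*_ (inv y (there y∈) σ a rich)
          (cong (P *_) (𝟙-cong (richAvoids? (σ [ y ]≔ a) c x) (richAvoids? σ c x)
            (λ f r → subst (_≢ c) at (f (rich← (proj₁ rich) σ a x r)))
            (λ f r → subst (_≢ c) (sym at) (f (rich→ (proj₁ rich) σ a x r)))))
          where
          at : lookup (σ [ y ]≔ a) x ≡ lookup σ x
          at = lookup∘update′ (All-lookup x∉ y∈) σ a

      -- A poor vertex is never the rich one being recoloured, and the recolouring leaves the set of
      -- poor vertices as it was.
      poorAvoid-invariant : ∀ c x → InvariantAt x (λ σ → 𝟙 (poorAvoid? σ c))
      poorAvoid-invariant c x σ a (Sx , b≤ℓ) = 𝟙-cong (poorAvoid? (σ [ x ]≔ a) c) (poorAvoid? σ c)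
        (λ f u poor → subst (_≢ c) (at u poor) (f u (poor← Sx σ a u poor)))
        (λ f u poor → subst (_≢ c) (sym (at u (poor→ Sx σ a u poor))) (f u (poor→ Sx σ a u poor)))
        where
        at : ∀ u → Poor σ u → lookup (σ [ x ]≔ a) u ≡ lookup σ u
        at u (_ , ℓ<b) = lookup∘update′ (λ { refl → <⇒≱ ℓ<b b≤ℓ }) σ a

      -- Divided by `P ^ m`, each summand stands for a lower bound on the chance that `c` is
      -- available at `v` after the rich neighbours are resampled and the poor ones kept. The
      -- product may run over all vertices because `p` vanishes where `Rich` fails.
      X : Vec (Fin P) m → ℕ
      X σ = ∑ C (λ c → 𝟙 (ok? v c) * (𝟙 (poorAvoid? σ c) * ∏ V (λ u → P ∸ p σ u c)))

      length-V : length V ≡ m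
      length-V = length-tabulate {n = m} id

      -- For each colour, `resample-all` turns the product into `P ^ m` times the indicator that the
      -- rich neighbours avoid it. An allowed colour avoided by the rich and the poor neighbours
      -- alike is available at `v`.
      ∑X≤ : Σσ (λ σ → pr H σ * X σ) ≤ P ^ m * Σσ (λ σ → pr H σ * # (avail? H σ v))
      ∑X≤ = begin
        Σσ (λ σ → pr H σ * X σ)
          ≡⟨ by-colour (λ σ c → 𝟙 (poorAvoid? σ c) * ∏ V (λ u → P ∸ p σ u c)) ⟩
        ∑ C (λ c → 𝟙 (ok? v c) * Σσ (λ σ → pr H σ * (𝟙 (poorAvoid? σ c) * ∏ V (λ u → P ∸ p σ u c))))
          ≤⟨ ∑-mono C (λ c → *-monoʳ-≤ (𝟙 (ok? v c))
               (resample-all c V (allFin⁺ m) (λ σ → 𝟙 (poorAvoid? σ c)) (λ x _ → poorAvoid-invariant c x))) ⟩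
        ∑ C (λ c → 𝟙 (ok? v c) * Σσ (λ σ → pr H σ * (𝟙 (poorAvoid? σ c) * ∏ V (λ u → P * 𝟙 (richAvoids? σ c u)))))
          ≡⟨ by-colour (λ σ c → 𝟙 (poorAvoid? σ c) * ∏ V (λ u → P * 𝟙 (richAvoids? σ c u))) ⟨
        Σσ (λ σ → pr H σ * ∑ C (λ c → 𝟙 (ok? v c) * (𝟙 (poorAvoid? σ c) * ∏ V (λ u → P * 𝟙 (richAvoids? σ c u)))))
          ≤⟨ ∑-mono (allVec P m) (λ σ → *-monoʳ-≤ (pr H σ) (≤-trans (∑-mono C (unused σ)) (≤-reflexive (∑-* C (P ^ m) _)))) ⟩
        Σσ (λ σ → pr H σ * (P ^ m * # (avail? H σ v)))
          ≡⟨ trans (∑-cong (allVec P m) (λ σ → rotate (pr H σ) (P ^ m) _)) (∑-* (allVec P m) (P ^ m) _) ⟩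
        P ^ m * Σσ (λ σ → pr H σ * # (avail? H σ v)) ∎
        where
        open ≤-Reasoning
        rotate : ∀ a b c → a * (b * c) ≡ b * (a * c)
        rotate = solve-∀
        by-colour : ∀ (Y : Vec (Fin P) m → Fin P → ℕ) →
          Σσ (λ σ → pr H σ * ∑ C (λ c → 𝟙 (ok? v c) * Y σ c)) ≡ ∑ C (λ c → 𝟙 (ok? v c) * Σσ (λ σ → pr H σ * Y σ c))
        by-colour Y = ≡.begin
          Σσ (λ σ → pr H σ * ∑ C (λ c → 𝟙 (ok? v c) * Y σ c))
            ≡.≡⟨ ∑-cong (allVec P m) (λ σ → ∑-* C (pr H σ) _) ⟨
          Σσ (λ σ → ∑ C (λ c → pr H σ * (𝟙 (ok? v c) * Y σ c)))
            ≡.≡⟨ ∑-swap (allVec P m) C _ ⟩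
          ∑ C (λ c → Σσ (λ σ → pr H σ * (𝟙 (ok? v c) * Y σ c)))
            ≡.≡⟨ ∑-cong C (λ c → trans (∑-cong (allVec P m) (λ σ → rotate (pr H σ) (𝟙 (ok? v c)) (Y σ c))) (∑-* (allVec P m) (𝟙 (ok? v c)) _)) ⟩
          ∑ C (λ c → 𝟙 (ok? v c) * Σσ (λ σ → pr H σ * Y σ c)) ≡.∎
          where module ≡ = ≡-Reasoning
        unused : ∀ σ c → 𝟙 (ok? v c) * (𝟙 (poorAvoid? σ c) * ∏ V (λ u → P * 𝟙 (richAvoids? σ c u))) ≤ P ^ m * 𝟙 (avail? H σ v c)
        unused σ c = begin
          𝟙 (ok? v c) * (𝟙 (poorAvoid? σ c) * ∏ V (λ u → P * 𝟙 (richAvoids? σ c u)))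
            ≡⟨ cong (λ i → 𝟙 (ok? v c) * (𝟙 (poorAvoid? σ c) * i)) (trans (∏-scale V P _) (cong (λ n → P ^ n * Ψ) length-V)) ⟩
          𝟙 (ok? v c) * (𝟙 (poorAvoid? σ c) * (P ^ m * Ψ))
            ≡⟨ shuffle (𝟙 (ok? v c)) (𝟙 (poorAvoid? σ c)) (P ^ m) Ψ ⟩
          P ^ m * (𝟙 (ok? v c) * (𝟙 (poorAvoid? σ c) * Ψ))
            ≤⟨ *-monoʳ-≤ (P ^ m) indicator ⟩
          P ^ m * 𝟙 (avail? H σ v c) ∎
          where
          Ψ = ∏ V (λ u → 𝟙 (richAvoids? σ c u))
          shuffle : ∀ a b c d → a * (b * (c * d)) ≡ c * (a * (b * d))
          shuffle = solve-∀
          indicator : 𝟙 (ok? v c) * (𝟙 (poorAvoid? σ c) * Ψ) ≤ 𝟙 (avail? H σ v c)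
          indicator with ok? v c
          ... | no _ = z≤n
          ... | yes ok with poorAvoid? σ c
          ... | no _ = z≤n
          ... | yes poorAvoid with all? (richAvoids? σ c)
          ... | yes richAvoid = ≤-trans (+-monoˡ-≤ 0 (+-monoˡ-≤ 0 (∏-𝟙≤1 V (richAvoids? σ c)))) (≤-reflexive (sym (𝟙-yes (avail? H σ v c) (ok , clear))))
            where
            clear : ∀ w → w ∈ H → Adj v w → lookup σ w ≢ c
            clear w w∈ vw with b ≤? ℓ σ w
            ... | yes b≤ℓ = richAvoid w ((w∈ , vw) , b≤ℓ)
            ... | no b≰ℓ  = poorAvoid w ((w∈ , vw) , ≰⇒> b≰ℓ)
          ... | no ¬richAvoid with ¬∀⟶∃¬ m _ (richAvoids? σ c) ¬richAvoid
          ... | u , ¬f = ≤-trans (≤-reflexive (trans (cong (λ i → 1 * (1 * i)) (∏≡0 (λ u → 𝟙 (richAvoids? σ c u)) (∈-allFin u) (𝟙-no (richAvoids? σ c u) ¬f))) refl)) z≤n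

      private
        K = 16 * R

      heavy : Vec (Fin P) m → ℕ
      heavy σ = ∑ C (λ c → 𝟙 (K * P ≤? ∑ V (λ u → p σ u c)))

      -- Markov's inequality: in units of `P` the exponents add up to at most `4 * R * q`, so the
      -- threshold `16 * R` is reached by at most a quarter of `q` colours.
      4heavy≤ : ∀ σ → 4 * heavy σ ≤ q
      4heavy≤ σ = *-cancelˡ-≤ (4 * R * P) ⦃ m*n≢0 (4 * R) P ⦃ m*n≢0 4 R ⦄ ⦄ (begin
        4 * R * P * (4 * heavy σ)               ≡⟨ lhs R P (heavy σ) ⟩
        K * P * heavy σ                         ≤⟨ markov C (λ c → ∑ V (λ u → p σ u c)) (K * P) ⟩
        ∑ C (λ c → ∑ V (λ u → p σ u c))         ≤⟨ ∑∑p≤ σ ⟩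
        4 * P * (R * q)                         ≡⟨ rhs R P q ⟩
        4 * R * P * q                           ∎)
        where
        open ≤-Reasoning
        lhs : ∀ r p h → 4 * r * p * (4 * h) ≡ 16 * r * p * h
        lhs = solve-∀
        rhs : ∀ r p q → 4 * p * (r * q) ≡ 4 * r * p * q
        rhs = solve-∀

      -- Of the at least `q` colours allowed at `v`, at most q/4 are heavy, and the poor vertices
      -- wear at most one colour each. By `∏-lower`, every remaining colour contributes at least
      -- `P ^ m` divided by `2 ^ κ R` to `X σ`.
      X-lower : ∀ σ → 3 * q * P ^ m ≤ 4 * 2 ^ κ R * X σ + 4 * P ^ m * # (poor? σ)
      X-lower σ = +-cancelʳ-≤ (P ^ m * q) _ _ (begin
        3 * q * P ^ m + P ^ m * q
          ≡⟨ lhs q (P ^ m) ⟩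
        4 * (P ^ m * q)
          ≤⟨ *-monoʳ-≤ 4 (*-monoʳ-≤ (P ^ m) (lists≥ v)) ⟩
        4 * (P ^ m * # (ok? v))
          ≡⟨ cong (4 *_) (∑-* C (P ^ m) _) ⟨
        4 * ∑ C (λ c → P ^ m * 𝟙 (ok? v c))
          ≤⟨ *-monoʳ-≤ 4 (∑-mono C pointwise) ⟩
        4 * ∑ C (λ c → 2 ^ κ R * x c + (P ^ m * usedByPoor c + P ^ m * 𝟙 (isHeavy? c)))
          ≡⟨ cong (4 *_) (trans (∑-+ C _ _) (cong₂ _+_ (∑-* C (2 ^ κ R) x) (trans (∑-+ C _ _) (cong₂ _+_ (trans (∑-* C (P ^ m) usedByPoor) (cong (P ^ m *_) (#-image (poor? σ) (lookup σ)))) (∑-* C (P ^ m) _))))) ⟩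
        4 * (2 ^ κ R * X σ + (P ^ m * # (poor? σ) + P ^ m * heavy σ))
          ≡⟨ rhs (2 ^ κ R) (X σ) (P ^ m) (# (poor? σ)) (heavy σ) ⟩
        4 * 2 ^ κ R * X σ + 4 * P ^ m * # (poor? σ) + P ^ m * (4 * heavy σ)
          ≤⟨ +-monoʳ-≤ (4 * 2 ^ κ R * X σ + 4 * P ^ m * # (poor? σ)) (*-monoʳ-≤ (P ^ m) (4heavy≤ σ)) ⟩
        4 * 2 ^ κ R * X σ + 4 * P ^ m * # (poor? σ) + P ^ m * q ∎)
        where
        open ≤-Reasoning
        lhs : ∀ q n → 3 * q * n + n * q ≡ 4 * (n * q)
        lhs = solve-∀
        rhs : ∀ k x n b h → 4 * (k * x + (n * b + n * h)) ≡ 4 * k * x + 4 * n * b + n * (4 * h)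
        rhs = solve-∀
        Π x usedByPoor : Fin P → ℕ
        Π c = ∏ V (λ u → P ∸ p σ u c)
        x c = 𝟙 (ok? v c) * (𝟙 (poorAvoid? σ c) * Π c)
        usedByPoor c = ∑ V (λ u → 𝟙 (poor? σ u) * 𝟙 (lookup σ u ≟ c))
        isHeavy? : ∀ c → Dec (K * P ≤ ∑ V (λ u → p σ u c))
        isHeavy? c = K * P ≤? ∑ V (λ u → p σ u c)
        poor-clash : ∀ c → ¬ PoorAvoid σ c → 1 ≤ usedByPoor c
        poor-clash c ¬avoid with ¬∀⟶∃¬ m _ (λ u → poor? σ u →-dec ¬? (lookup σ u ≟ c)) ¬avoid
        ... | u , ¬f with poor? σ u
        ... | no ¬poor = contradiction (λ poor → contradiction poor ¬poor) ¬f
        ... | yes poor with lookup σ u ≟ c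
        ... | no neq = contradiction (λ _ → neq) ¬f
        ... | yes eq = ≤-trans (≤-reflexive (sym (cong₂ _*_ (𝟙-yes (poor? σ u) poor) (𝟙-yes (lookup σ u ≟ c) eq))))
          (∑-member (λ u → 𝟙 (poor? σ u) * 𝟙 (lookup σ u ≟ c)) (∈-allFin u))
        pointwise : ∀ c → P ^ m * 𝟙 (ok? v c) ≤ 2 ^ κ R * x c + (P ^ m * usedByPoor c + P ^ m * 𝟙 (isHeavy? c))
        pointwise c with ok? v c
        ... | no _ = ≤-trans (≤-reflexive (*-zeroʳ (P ^ m))) z≤n
        ... | yes _ with isHeavy? c
        ... | yes _ = ≤-trans (m≤n+m (P ^ m * 1) (P ^ m * usedByPoor c))
          (m≤n+m _ (2 ^ κ R * (1 * (𝟙 (poorAvoid? σ c) * Π c))))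
        ... | no light with poorAvoid? σ c
        ... | no ¬avoid = ≤-trans (*-monoʳ-≤ (P ^ m) (poor-clash c ¬avoid)) 
          (≤-trans (m≤m+n (P ^ m * usedByPoor c) (P ^ m * 0)) (m≤n+m _ (2 ^ κ R * (1 * (0 * Π c)))))
        ... | yes _ = begin
          P ^ m * 1
            ≡⟨ trans (*-identityʳ _) (cong (P ^_) (sym length-V)) ⟩
          P ^ length V
            ≤⟨ ∏-lower P K (λ u → p σ u c) V (p-small σ c) (<⇒≤ (≰⇒> light)) ⟩
          2 ^ κ R * Π c
            ≡⟨ cong (2 ^ κ R *_) (trans (*-identityˡ _) (*-identityˡ _)) ⟨
          2 ^ κ R * (1 * (1 * Π c))
            ≤⟨ m≤m+n _ _ ⟩
          2 ^ κ R * (1 * (1 * Π c)) + (P ^ m * usedByPoor c + P ^ m * 0) ∎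

      -- Averaging `X-lower`, the poor vertices cost q/8 of the 3q/4 colours, which leaves 5q/8.
      -- Only q/2 is kept (the loss is doubled in the last estimate but one), since q/2 divided by
      -- `2 ^ κ R` is `8 * R * b` by the choice of `W`.
      expected-at : 8 * R * b * Z H ≤ Σσ (λ σ → pr H σ * # (avail? H σ v))
      expected-at = *-cancelˡ-≤ (4 * (2 * k * N)) ⦃ nonZero ⦄ (+-cancelʳ-≤ (2 * q * N * Z H) _ _ (begin
        4 * (2 * k * N) * (8 * R * b * Z H) + 2 * q * N * Z H
          ≡⟨ lhs (2 ^ κ R) (P ^ m) R b (Z H) ⟩
        2 * (Z H * (3 * q * N))
          ≡⟨ cong (2 *_) (trans (*-comm (Z H) _) (trans (sym (∑-* (allVec P m) (3 * q * N) (pr H))) (∑-cong (allVec P m) (λ σ → *-comm (3 * q * N) (pr H σ))))) ⟩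
        2 * Σσ (λ σ → pr H σ * (3 * q * N))
          ≤⟨ *-monoʳ-≤ 2 (∑-mono (allVec P m) (λ σ → *-monoʳ-≤ (pr H σ) (X-lower σ))) ⟩
        2 * Σσ (λ σ → pr H σ * (4 * k * X σ + 4 * N * # (poor? σ)))
          ≡⟨ cong (2 *_) (trans (∑-cong (allVec P m) (λ σ → distribute (pr H σ) (4 * k) (X σ) (4 * N) (# (poor? σ))))
               (trans (∑-+ (allVec P m) _ _) (cong₂ _+_ (∑-* (allVec P m) (4 * k) _) (∑-* (allVec P m) (4 * N) _)))) ⟩
        2 * (4 * k * Σσ (λ σ → pr H σ * X σ) + 4 * N * Σσ (λ σ → pr H σ * # (poor? σ)))
          ≡⟨ mid k (Σσ (λ σ → pr H σ * X σ)) N (Σσ (λ σ → pr H σ * # (poor? σ))) ⟩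
        8 * k * Σσ (λ σ → pr H σ * X σ) + N * (8 * Σσ (λ σ → pr H σ * # (poor? σ)))
          ≤⟨ +-mono-≤ (*-monoʳ-≤ (8 * k) ∑X≤) (*-monoʳ-≤ N ∑-poor≤) ⟩
        8 * k * (N * E) + N * (q * Z H)
          ≤⟨ +-monoʳ-≤ (8 * k * (N * E)) (m≤m+n _ (N * (q * Z H))) ⟩
        8 * k * (N * E) + (N * (q * Z H) + N * (q * Z H))
          ≡⟨ rhs k N E q (Z H) ⟩
        4 * (2 * k * N) * E + 2 * q * N * Z H ∎))
        where
        open ≤-Reasoning
        k = 2 ^ κ R
        N = P ^ m
        E = Σσ (λ σ → pr H σ * # (avail? H σ v))
        nonZero : NonZero (4 * (2 * k * N))
        nonZero = m*n≢0 4 (2 * k * N) ⦃ _ ⦄ ⦃ m*n≢0 (2 * k) N ⦃ m*n≢0 2 k ⦃ _ ⦄ ⦃ m^n≢0 2 (κ R) ⦄ ⦄ ⦃ m^n≢0 P m ⦄ ⦄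
        lhs : ∀ k n r b z → 4 * (2 * k * n) * (8 * r * b * z) + 2 * (8 * r * (2 * k) * b) * n * z ≡ 2 * (z * (3 * (8 * r * (2 * k) * b) * n))
        lhs = solve-∀
        distribute : ∀ a b c d e → a * (b * c + d * e) ≡ b * (a * c) + d * (a * e)
        distribute = solve-∀
        mid : ∀ k x n b → 2 * (4 * k * x + 4 * n * b) ≡ 8 * k * x + n * (8 * b)
        mid = solve-∀
        rhs : ∀ k n e q z → 8 * k * (n * e) + (n * (q * z) + n * (q * z)) ≡ 4 * (2 * k * n) * e + 2 * q * n * z
        rhs = solve-∀

    expected-available : ∀ H → Expected H
    expected-available H = bySize ∣ H ∣ H refl
      where
      bySize : ∀ s H → ∣ H ∣ ≡ s → Expected H
      bySize = <-rec (λ s → ∀ H → ∣ H ∣ ≡ s → Expected H)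
        (λ s rec H eq v → Step.expected-at H v (λ u u∈ → rec (subst (_ <_) eq (x∈p⇒∣p-x∣<∣p∣ u∈)) (H - u) refl))

    -- If `H - u` has a proper colouring, then the average number of colours available at `u` is
    -- positive, so some colouring of `H - u` extends to `u`.
    Z-positive : ∀ H → 0 < Z H
    Z-positive H = bySize ∣ H ∣ H refl
      where
      open ≤-Reasoning
      bySize : ∀ s H → ∣ H ∣ ≡ s → 0 < Z H
      bySize = <-rec (λ s → ∀ H → ∣ H ∣ ≡ s → 0 < Z H) λ s rec H eq → step s rec H eq (nonempty? H)
        where
        step : ∀ s → (∀ {r} → r < s → ∀ H → ∣ H ∣ ≡ r → 0 < Z H) → ∀ H → ∣ H ∣ ≡ s → Dec (∃ (_∈ H)) → 0 < Z H
        step s rec H eq (no empty) = begin-strict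
          0                <⟨ ∑-allVec-positive P m (n≢0⇒n>0 (≢-nonZero⁻¹ P)) ⟩
          Σσ (λ _ → 1)     ≡⟨ ∑-cong (allVec P m) (λ σ → sym (𝟙-yes (proper? H σ) (λ u u∈ → contradiction (u , u∈) empty))) ⟩
          Z H              ∎
        step s rec H eq (yes (u , u∈)) = *-cancelˡ-< P 0 (Z H) (begin-strict
          P * 0                                                        ≡⟨ *-zeroʳ P ⟩
          0                                                            <⟨ *-mono-< 0<M (rec (subst (_ <_) eq (x∈p⇒∣p-x∣<∣p∣ u∈)) (H - u) refl) ⟩
          8 * R * b * Z (H - u)                                        ≤⟨ expected-available (H - u) u ⟩
          Σσ (λ σ → pr (H - u) σ * # (avail? (H - u) σ u))             ≡⟨ Z-remove u∈ ⟨
          P * Z H                                                      ∎)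
          where
          0<M : 0 < 8 * R * b
          0<M = *-mono-< (*-mono-< (s≤s (z≤n {7})) (n≢0⇒n>0 (≢-nonZero⁻¹ R))) (≤-trans (s≤s z≤n) 16≤b)

    list-colouring : ∃ λ (σ : Fin m → Fin P) → (∀ u → Ok u (σ u)) × (∀ u w → Adj u w → σ u ≢ σ w)
    list-colouring with ∑-positive (allVec P m) (pr ⊤) (Z-positive ⊤)
    ... | σ , 0<pr with proper? ⊤ σ
    ... | yes pf = lookup σ , (λ u → proj₁ (pf u ∈⊤)) , λ u w uw → proj₂ (pf u ∈⊤) w ∈⊤ uw
    ... | no _ = contradiction 0<pr λ ()

-- Double counting in linear hypergraphs.

module Linearity where
  open import Data.Nat using (ℕ; zero; suc; _+_; _*_; _≤_; z≤n; s≤s; NonZero)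
  open import Data.Nat.Properties hiding (_≟_; _≤?_; _<?_)
  open import Data.Nat.Tactic.RingSolver using (solve-∀)
  open import Data.Fin using (Fin; zero; suc)
  open import Data.Fin.Properties using (_≟_; any?)
  open import Data.Fin.Subset using (Subset; _∈_; _∩_; ∣_∣; Nonempty; inside; outside)
  open import Data.Fin.Subset.Properties using (_∈?_; x∈p∩q⁺; x∈p∩q⁻; nonempty?; ∩-comm)
  open import Data.List using (List; []; _∷_; length; allFin)
  open import Data.List.Membership.Propositional.Properties using (∈-allFin)
  open import Data.Vec using ([]; _∷_; there)
  open import Data.Product using (_×_; _,_; proj₁; proj₂)
  open import Relation.Nullary using (Dec; yes; no; contradiction)
  open import Relation.Nullary.Decidable using (¬?; _×-dec_)
  open import Relation.Binary.PropositionalEquality hiding ([_])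
  open Sums

  #≤1 : ∀ {n} {P : Fin n → Set} (P? : ∀ i → Dec (P i)) → (∀ i j → P i → P j → i ≡ j) → # P? ≤ 1
  #≤1 {n} P? unique with any? P?
  ... | yes (i , Pi) = ≤-trans (#-mono P? (i ≟_) (λ j → unique i j Pi)) (≤-reflexive (∑-delta i))
  ... | no ¬any = ≤-trans (≤-reflexive (trans (∑-cong (allFin n) (λ i → 𝟙-no (P? i) (λ Pi → ¬any (i , Pi))))
                    (trans (∑-allFin-const n 0) (*-zeroʳ n)))) z≤n

  ∣∣≡# : ∀ {n} (p : Subset n) → ∣ p ∣ ≡ # (_∈? p)
  ∣∣≡# []            = refl
  ∣∣≡# {suc n} (s ∷ p) = trans (split s) (sym (∑-allFin-suc n (λ v → 𝟙 (v ∈? (s ∷ p)))))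
    where
    tail≡ : ∣ p ∣ ≡ ∑ (allFin n) (λ v → 𝟙 (suc v ∈? (s ∷ p)))
    tail≡ = trans (∣∣≡# p) (#-cong (_∈? p) (λ v → suc v ∈? (s ∷ p)) (λ _ → there) (λ { _ (there v∈) → v∈ }))
    split : ∀ t → ∣ t ∷ p ∣ ≡ 𝟙 (zero ∈? (t ∷ p)) + ∑ (allFin n) (λ v → 𝟙 (suc v ∈? (s ∷ p)))
    split inside  = cong suc tail≡
    split outside = tail≡

  two-members : ∀ {n} {p : Subset n} {v w} → v ≢ w → v ∈ p → w ∈ p → 2 ≤ ∣ p ∣
  two-members {n} {p} {v} {w} v≢w v∈ w∈ = begin
    2                                                  ≡⟨ cong₂ _+_ (∑-delta v) (∑-delta w) ⟨
    # (v ≟_) + # (w ≟_)                                ≡⟨ ∑-+ (allFin n) _ _ ⟨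
    ∑ (allFin n) (λ u → 𝟙 (v ≟ u) + 𝟙 (w ≟ u))         ≤⟨ ∑-mono (allFin n) one ⟩
    # (_∈? p)                                          ≡⟨ ∣∣≡# p ⟨
    ∣ p ∣                                              ∎
    where
    open ≤-Reasoning
    one : ∀ u → 𝟙 (v ≟ u) + 𝟙 (w ≟ u) ≤ 𝟙 (u ∈? p)
    one u with v ≟ u | w ≟ u
    ... | yes refl | yes refl = contradiction refl v≢w
    ... | yes refl | no _     = ≤-reflexive (sym (𝟙-yes (v ∈? p) v∈))
    ... | no _     | yes refl = ≤-reflexive (sym (𝟙-yes (w ∈? p) w∈))
    ... | no _     | no _     = z≤n

  module _ {n : ℕ} (H : Hypergraph n) (linear : Linear H) where

    private
      V : List (Fin n)
      V = allFin n

      Edges : List (Fin (m H))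
      Edges = allFin (m H)

    Meets : Fin (m H) → Fin (m H) → Set
    Meets e f = Nonempty (edge H e ∩ edge H f)

    meets-sym : ∀ {e f} → Meets e f → Meets f e
    meets-sym {e} {f} = subst Nonempty (∩-comm (edge H e) (edge H f))

    abstract
      meets? : ∀ e f → Dec (Meets e f)
      meets? e f = nonempty? (edge H e ∩ edge H f)

    inc : Fin n → Fin (m H) → ℕ
    inc v e = 𝟙 (v ∈? edge H e)

    inc-∈ : ∀ {v e} → v ∈ edge H e → inc v e ≡ 1
    inc-∈ {v} {e} = 𝟙-yes (v ∈? edge H e)

    size≡∑ : ∀ e → edgeSize H e ≡ ∑ V (λ v → inc v e)
    size≡∑ e = ∣∣≡# (edge H e)

    degree≡∑ : ∀ v → degree H v ≡ ∑ Edges (inc v)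
    degree≡∑ v = length-filter (λ e → v ∈? edge H e) Edges

    size-positive : ∀ e → 1 ≤ edgeSize H e
    size-positive e = ≤-trans (#-witness (_∈? edge H e) (proj₂ (nonempty H e))) (≤-reflexive (sym (size≡∑ e)))

    size≤n : ∀ e → edgeSize H e ≤ n
    size≤n e = ≤-trans (≤-reflexive (size≡∑ e)) (#≤n (_∈? edge H e))

    -- Two edges through both `v` and `w` would share two vertices.
    codegree≤1 : ∀ {v w} → v ≢ w → ∑ Edges (λ e → inc v e * inc w e) ≤ 1
    codegree≤1 {v} {w} v≢w = ≤-trans
      (≤-reflexive (∑-cong Edges (λ e → sym (𝟙-× (v ∈? edge H e) (w ∈? edge H e)))))
      (#≤1 (λ e → (v ∈? edge H e) ×-dec (w ∈? edge H e)) unique)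
      where
      unique : ∀ e f → v ∈ edge H e × w ∈ edge H e → v ∈ edge H f × w ∈ edge H f → e ≡ f
      unique e f (ve , we) (vf , wf) with e ≟ f
      ... | yes e≡f = e≡f
      ... | no e≢f = contradiction (two-members v≢w (x∈p∩q⁺ (ve , vf)) (x∈p∩q⁺ (we , wf))) (<⇒≱ (s≤s (linear e f e≢f)))

    ∑-inc*inc≤1 : ∀ {e f} → e ≢ f → ∑ V (λ v → inc v e * inc v f) ≤ 1
    ∑-inc*inc≤1 {e} {f} e≢f = begin
      ∑ V (λ v → inc v e * inc v f)         ≡⟨ ∑-cong V (λ v → sym (𝟙-× (v ∈? edge H e) (v ∈? edge H f))) ⟩
      # (λ v → (v ∈? edge H e) ×-dec (v ∈? edge H f))
        ≤⟨ #-mono (λ v → (v ∈? edge H e) ×-dec (v ∈? edge H f)) (_∈? (edge H e ∩ edge H f)) (λ _ → x∈p∩q⁺) ⟩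
      # (_∈? (edge H e ∩ edge H f))         ≡⟨ ∣∣≡# (edge H e ∩ edge H f) ⟨
      ∣ edge H e ∩ edge H f ∣               ≤⟨ linear e f e≢f ⟩
      1                                     ∎
      where open ≤-Reasoning

    module _ (degree≤n : ∀ v → degree H v ≤ n) where

      -- The sum counts pairs of an edge through `v` and a vertex `w` on it. Each `w` other than `v`
      -- occurs at most once by linearity, and `w = v` occurs `degree H v` times; the two kinds give
      -- at most `n` each.
      ∑-size-at : ∀ v → ∑ Edges (λ e → inc v e * edgeSize H e) ≤ 2 * n
      ∑-size-at v = begin
        ∑ Edges (λ e → inc v e * edgeSize H e)
          ≡⟨ ∑-cong Edges (λ e → trans (cong (inc v e *_) (size≡∑ e)) (sym (∑-* V (inc v e) _))) ⟩
        ∑ Edges (λ e → ∑ V (λ w → inc v e * inc w e))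
          ≡⟨ ∑-swap Edges V _ ⟩
        ∑ V (λ w → ∑ Edges (λ e → inc v e * inc w e))
          ≤⟨ ∑-mono V one ⟩
        ∑ V (λ w → 1 + n * 𝟙 (v ≟ w))
          ≡⟨ trans (∑-+ V _ _) (cong₂ _+_ (trans (∑-allFin-const n 1) (*-comm n 1)) (∑-* V n _)) ⟩
        1 * n + n * # (v ≟_)
          ≡⟨ cong (λ k → 1 * n + n * k) (∑-delta v) ⟩
        1 * n + n * 1
          ≡⟨ double n ⟩
        2 * n ∎
        where
        open ≤-Reasoning
        double : ∀ n → 1 * n + n * 1 ≡ 2 * n
        double = solve-∀
        one : ∀ w → ∑ Edges (λ e → inc v e * inc w e) ≤ 1 + n * 𝟙 (v ≟ w)
        one w with v ≟ w
        ... | no v≢w = ≤-trans (codegree≤1 v≢w) (m≤m+n 1 (n * 0))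
        ... | yes refl = begin
          ∑ Edges (λ e → inc v e * inc v e)   ≤⟨ ∑-mono Edges (λ e → ≤-trans (*-monoʳ-≤ (inc v e) (𝟙≤1 (v ∈? edge H e))) (≤-reflexive (*-identityʳ _))) ⟩
          ∑ Edges (inc v)                     ≡⟨ degree≡∑ v ⟨
          degree H v                          ≤⟨ degree≤n v ⟩
          n                                   ≡⟨ *-identityʳ n ⟨
          n * 1                               ≤⟨ n≤1+n (n * 1) ⟩
          1 + n * 1                           ∎

      #-meeting : ∀ {k e} {Q : Fin (m H) → Set} (Q? : ∀ f → Dec (Q f)) →
        (∀ f → Q f → Meets e f) → (∀ f → Q f → k ≤ edgeSize H f) → k * # Q? ≤ edgeSize H e * (2 * n)
      #-meeting {k} {e} {Q} Q? meets k≤ = begin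
        k * # Q?
          ≡⟨ ∑-* Edges k _ ⟨
        ∑ Edges (λ f → k * 𝟙 (Q? f))
          ≤⟨ ∑-mono Edges one ⟩
        ∑ Edges (λ f → ∑ V (λ v → inc v e * (inc v f * edgeSize H f)))
          ≡⟨ ∑-swap Edges V _ ⟩
        ∑ V (λ v → ∑ Edges (λ f → inc v e * (inc v f * edgeSize H f)))
          ≡⟨ ∑-cong V (λ v → ∑-* Edges (inc v e) _) ⟩
        ∑ V (λ v → inc v e * ∑ Edges (λ f → inc v f * edgeSize H f))
          ≤⟨ ∑-mono V (λ v → ≤-trans (*-monoʳ-≤ (inc v e) (∑-size-at v)) (≤-reflexive (*-comm (inc v e) _))) ⟩
        ∑ V (λ v → 2 * n * inc v e)
          ≡⟨ trans (∑-* V (2 * n) _) (cong (2 * n *_) (sym (size≡∑ e))) ⟩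
        2 * n * edgeSize H e
          ≡⟨ *-comm (2 * n) _ ⟩
        edgeSize H e * (2 * n) ∎
        where
        open ≤-Reasoning
        -- A vertex shared by `e` and `f` already contributes the whole size of `f`, at least `k`.
        -- On the other side, `∑-size-at` limits what each vertex of `e` can contribute, so large
        -- edges meeting `e` are few.
        one : ∀ f → k * 𝟙 (Q? f) ≤ ∑ V (λ v → inc v e * (inc v f * edgeSize H f))
        one f with Q? f
        ... | no _ = ≤-trans (≤-reflexive (*-zeroʳ k)) z≤n
        ... | yes q with meets f q
        ... | v , v∈ = begin
          k * 1                                               ≡⟨ *-identityʳ k ⟩
          k                                                   ≤⟨ k≤ f q ⟩
          edgeSize H f                                        ≡⟨ trans (*-identityˡ _) (*-identityˡ _) ⟨
          1 * (1 * edgeSize H f)                              ≡⟨ cong₂ (λ i j → i * (j * edgeSize H f)) (inc-∈ (proj₁ ves)) (inc-∈ (proj₂ ves)) ⟨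
          inc v e * (inc v f * edgeSize H f)                  ≤⟨ ∑-member (λ v → inc v e * (inc v f * edgeSize H f)) (∈-allFin v) ⟩
          ∑ V (λ v → inc v e * (inc v f * edgeSize H f))      ∎
          where
          ves = x∈p∩q⁻ (edge H e) (edge H f) v∈

      -- `∑-size-at` summed over all vertices: an edge is met at each of its vertices and counts its
      -- size every time.
      ∑-size² : ∑ Edges (λ f → edgeSize H f * edgeSize H f) ≤ n * (2 * n)
      ∑-size² = begin
        ∑ Edges (λ f → edgeSize H f * edgeSize H f)
          ≡⟨ ∑-cong Edges (λ f → trans (cong (edgeSize H f *_) (size≡∑ f)) (trans (sym (∑-* V (edgeSize H f) _)) (∑-cong V (λ v → *-comm (edgeSize H f) (inc v f))))) ⟩
        ∑ Edges (λ f → ∑ V (λ v → inc v f * edgeSize H f))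
          ≡⟨ ∑-swap Edges V _ ⟩
        ∑ V (λ v → ∑ Edges (λ f → inc v f * edgeSize H f))
          ≤⟨ ∑-mono V ∑-size-at ⟩
        ∑ V (λ _ → 2 * n)
          ≡⟨ ∑-allFin-const n (2 * n) ⟩
        n * (2 * n) ∎
        where open ≤-Reasoning

      #-large : ∀ {k} .{{_ : NonZero n}} {Q : Fin (m H) → Set} (Q? : ∀ f → Dec (Q f)) →
        (∀ f → Q f → k * n ≤ edgeSize H f * edgeSize H f) → k * # Q? ≤ 2 * n
      #-large {k} Q? large = *-cancelˡ-≤ n (begin
        n * (k * # Q?)                                   ≡⟨ rotate n k (# Q?) ⟩
        k * n * # Q?                                     ≡⟨ ∑-* Edges (k * n) _ ⟨
        ∑ Edges (λ f → k * n * 𝟙 (Q? f))                 ≤⟨ ∑-mono Edges one ⟩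
        ∑ Edges (λ f → edgeSize H f * edgeSize H f)      ≤⟨ ∑-size² ⟩
        n * (2 * n)                                      ∎)
        where
        open ≤-Reasoning
        rotate : ∀ n k q → n * (k * q) ≡ k * n * q
        rotate = solve-∀
        one : ∀ f → k * n * 𝟙 (Q? f) ≤ edgeSize H f * edgeSize H f
        one f with Q? f
        ... | no _ = ≤-trans (≤-reflexive (*-zeroʳ (k * n))) z≤n
        ... | yes q = ≤-trans (≤-reflexive (*-identityʳ _)) (large f q)

    -- An edge g meeting e and f passes through the vertex of e ∩ f, or joins a vertex of e to a different vertex of f.
    #-common : ∀ {h D e f} → e ≢ f → (∀ v → h * degree H v ≤ D) →
      {Q : Fin (m H) → Set} (Q? : ∀ g → Dec (Q g)) → (∀ g → Q g → Meets g e × Meets g f) →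
      h * # Q? ≤ D + h * (edgeSize H e * edgeSize H f)
    #-common {h} {D} {e} {f} e≢f degree≤ {Q} Q? meets = begin
      h * # Q?
        ≤⟨ *-monoʳ-≤ h (≤-trans (∑-mono Edges one) (≤-reflexive (∑-+ Edges _ _))) ⟩
      h * (∑ Edges same + ∑ Edges different)
        ≡⟨ *-distribˡ-+ h (∑ Edges same) _ ⟩
      h * ∑ Edges same + h * ∑ Edges different
        ≤⟨ +-mono-≤ same≤ (*-monoʳ-≤ h different≤) ⟩
      D + h * (edgeSize H e * edgeSize H f) ∎
      where
      open ≤-Reasoning
      same different : Fin (m H) → ℕ
      same g      = ∑ V (λ v → inc v e * inc v f * inc v g)
      different g = ∑ V (λ v → ∑ V (λ w → inc v e * inc w f * (𝟙 (¬? (v ≟ w)) * (inc v g * inc w g))))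
      same≤ : h * ∑ Edges same ≤ D
      same≤ = begin
        h * ∑ Edges same
          ≡⟨ cong (h *_) (trans (∑-swap Edges V _) (∑-cong V (λ v → trans (∑-* Edges (inc v e * inc v f) _) (cong (inc v e * inc v f *_) (sym (degree≡∑ v)))))) ⟩
        h * ∑ V (λ v → inc v e * inc v f * degree H v)
          ≡⟨ ∑-* V h _ ⟨
        ∑ V (λ v → h * (inc v e * inc v f * degree H v))
          ≤⟨ ∑-mono V (λ v → ≤-trans (≤-reflexive (shuffle h (inc v e * inc v f) _)) (*-monoˡ-≤ (inc v e * inc v f) (degree≤ v))) ⟩
        ∑ V (λ v → D * (inc v e * inc v f))
          ≡⟨ ∑-* V D _ ⟩
        D * ∑ V (λ v → inc v e * inc v f)
          ≤⟨ *-monoʳ-≤ D (∑-inc*inc≤1 e≢f) ⟩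
        D * 1
          ≡⟨ *-identityʳ D ⟩
        D ∎
        where
        shuffle : ∀ h a d → h * (a * d) ≡ h * d * a
        shuffle = solve-∀
      pairs : ∀ v w → ∑ Edges (λ g → 𝟙 (¬? (v ≟ w)) * (inc v g * inc w g)) ≤ 1
      pairs v w with v ≟ w
      ... | yes _ = ≤-trans (≤-reflexive (trans (∑-const Edges 0) (*-zeroʳ (length Edges)))) z≤n
      ... | no v≢w = ≤-trans (≤-reflexive (∑-cong Edges (λ g → *-identityˡ _))) (codegree≤1 v≢w)
      different≤ : ∑ Edges different ≤ edgeSize H e * edgeSize H f
      different≤ = begin
        ∑ Edges different
          ≡⟨ trans (∑-swap Edges V _) (∑-cong V (λ v → trans (∑-swap Edges V _) (∑-cong V (λ w → ∑-* Edges (inc v e * inc w f) _)))) ⟩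
        ∑ V (λ v → ∑ V (λ w → inc v e * inc w f * ∑ Edges (λ g → 𝟙 (¬? (v ≟ w)) * (inc v g * inc w g))))
          ≤⟨ ∑-mono V (λ v → ∑-mono V (λ w → ≤-trans (*-monoʳ-≤ (inc v e * inc w f) (pairs v w)) (≤-reflexive (*-identityʳ _)))) ⟩
        ∑ V (λ v → ∑ V (λ w → inc v e * inc w f))
          ≡⟨ ∑-cong V (λ v → trans (∑-* V (inc v e) _) (trans (cong (inc v e *_) (sym (size≡∑ f))) (*-comm (inc v e) _))) ⟩
        ∑ V (λ v → edgeSize H f * inc v e)
          ≡⟨ trans (∑-* V (edgeSize H f) _) (cong (edgeSize H f *_) (sym (size≡∑ e))) ⟩
        edgeSize H f * edgeSize H e
          ≡⟨ *-comm (edgeSize H f) _ ⟩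
        edgeSize H e * edgeSize H f ∎
      one : ∀ g → 𝟙 (Q? g) ≤ same g + different g
      one g with Q? g
      ... | no _ = z≤n
      ... | yes q with meets g q
      ... | (v , v∈) , (w , w∈) with x∈p∩q⁻ (edge H g) (edge H e) v∈ | x∈p∩q⁻ (edge H g) (edge H f) w∈ | v ≟ w
      ... | vg , ve | wg , wf | yes refl = ≤-trans
        (≤-trans (≤-reflexive (sym (cong₂ _*_ (cong₂ _*_ (inc-∈ ve) (inc-∈ wf)) (inc-∈ vg))))
                 (∑-member (λ v → inc v e * inc v f * inc v g) (∈-allFin v)))
        (m≤m+n (same g) (different g))
      ... | vg , ve | wg , wf | no v≢w = ≤-trans
        (≤-trans (≤-reflexive (sym (cong₂ _*_ (cong₂ _*_ (inc-∈ ve) (inc-∈ wf)) (cong₂ _*_ (𝟙-yes (¬? (v ≟ w)) v≢w) (cong₂ _*_ (inc-∈ vg) (inc-∈ wg))))))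
          (≤-trans (∑-member (λ w → inc v e * inc w f * (𝟙 (¬? (v ≟ w)) * (inc v g * inc w g))) (∈-allFin w))
                   (∑-member (λ v → ∑ V (λ w → inc v e * inc w f * (𝟙 (¬? (v ≟ w)) * (inc v g * inc w g)))) (∈-allFin v))))
        (m≤n+m (different g) (same g))

-- Grouping the small edges by size and colouring group by group.

module Levels where
  open import Data.Nat using (ℕ; zero; suc; _+_; _*_; _^_; _≤_; _<_; _≤?_; _<?_; z≤n; s≤s; NonZero; ≢-nonZero⁻¹; >-nonZero)
  open import Data.Nat.Properties hiding (_≤?_; _<?_)
  open import Data.Nat.Tactic.RingSolver using (solve-∀)
  open import Data.Bool using (Bool; false; not)
  open import Data.Bool.Properties using (not-¬) renaming (_≟_ to _≟ᵇ_)
  open import Data.Fin using (Fin; zero; fromℕ<)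
  open import Data.Fin.Properties using (all?; ¬∀⟶∃¬) renaming (_≟_ to _≟ᶠ_)
  open import Data.List using (allFin)
  open import Data.List.Membership.Propositional.Properties using (∈-allFin)
  open import Data.Product using (_×_; _,_; proj₁; proj₂; ∃)
  open import Data.Sum using (inj₁; inj₂)
  open import Relation.Nullary using (Dec; yes; no; ¬_; contradiction)
  open import Relation.Nullary.Decidable using (¬?; _×-dec_; _→-dec_)
  open import Relation.Binary.PropositionalEquality hiding ([_])
  open Sums
  open LocallySparse using (W; list-colouring)
  open Linearity

  level : ∀ L → 2 ≤ L → ∀ s → 1 ≤ s → ∃ λ i → L ^ i ≤ s × s < L ^ suc i
  level L 2≤L (suc zero) _ = 0 , ≤-refl , ≤-trans 2≤L (≤-reflexive (sym (*-identityʳ L)))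
  level L 2≤L (suc (suc s)) _ with level L 2≤L (suc s) (s≤s z≤n)
  ... | i , L^i≤ , <L^ with suc (suc s) <? L ^ suc i
  ... | yes <L^′ = i , m≤n⇒m≤1+n L^i≤ , <L^′
  ... | no ≮L^ = suc i , ≮⇒≥ ≮L^ , (begin-strict
    suc (suc s)              ≤⟨ <L^ ⟩
    L ^ suc i                <⟨ m<m+n (L ^ suc i) (≤-trans (s≤s z≤n) <L^) ⟩
    L ^ suc i + L ^ suc i    ≡⟨ cong (L ^ suc i +_) (+-identityʳ (L ^ suc i)) ⟨
    2 * L ^ suc i            ≤⟨ *-monoˡ-≤ (L ^ suc i) 2≤L ⟩
    L ^ suc (suc i)          ∎)
    where open ≤-Reasoning

  n<2^n : ∀ n → n < 2 ^ n
  n<2^n zero    = s≤s z≤n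
  n<2^n (suc n) = begin-strict
    suc n              ≤⟨ n<2^n n ⟩
    2 ^ n              <⟨ m<m+n (2 ^ n) (≤-trans (s≤s z≤n) (n<2^n n)) ⟩
    2 ^ n + 2 ^ n      ≡⟨ cong (2 ^ n +_) (+-identityʳ (2 ^ n)) ⟨
    2 ^ suc n          ∎
    where open ≤-Reasoning

  parity : ℕ → Bool
  parity zero    = false
  parity (suc n) = not (parity n)

  parity-gap : ∀ {i j} → parity i ≡ parity j → i < j → 2 + i ≤ j
  parity-gap {i} {j} same i<j with suc i ≟ j
  ... | yes refl = contradiction same (not-¬ refl)
  ... | no neq = ≤∧≢⇒< i<j neq

  module _ {n : ℕ} (H : Hypergraph n) (linear : Linear H) {P : ℕ} .{{_ : NonZero P}}
    (L R b h : ℕ) .{{_ : NonZero R}} .{{_ : NonZero h}} (2≤L : 2 ≤ L) (16≤b : 16 ≤ b)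
    (hdegree≤n : ∀ v → h * degree H v ≤ n)
    (2nL≤ : 2 * n * L ≤ R * (W R * b))
    (4n≤ : 4 * n ≤ h * b)
    -- `F` will be the number of edges in higher groups that conflict with a given edge; the list
    -- that survives them must still have `W R * b` colours.
    (room : ∀ F → L * F ≤ 2 * n → W R * b + F ≤ P)
    where

    private
      size : Fin (m H) → ℕ
      size = edgeSize H

      degree≤n : ∀ v → degree H v ≤ n
      degree≤n v = ≤-trans (m≤n*m (degree H v) h) (hdegree≤n v)

      instance
        L≢0 : NonZero L
        L≢0 = >-nonZero (≤-trans (s≤s z≤n) 2≤L)

    lev : Fin (m H) → ℕ
    lev e = proj₁ (level L 2≤L (size e) (size-positive H linear e))

    lev-lower : ∀ e → L ^ lev e ≤ size e
    lev-lower e = proj₁ (proj₂ (level L 2≤L (size e) (size-positive H linear e)))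

    lev-upper : ∀ e → size e < L ^ suc (lev e)
    lev-upper e = proj₂ (proj₂ (level L 2≤L (size e) (size-positive H linear e)))

    lev<n : ∀ e → lev e < n
    lev<n e = begin-strict
      lev e            <⟨ n<2^n (lev e) ⟩
      2 ^ lev e        ≤⟨ ^-monoˡ-≤ (lev e) 2≤L ⟩
      L ^ lev e        ≤⟨ lev-lower e ⟩
      size e           ≤⟨ size≤n H linear e ⟩
      n                ∎
      where open ≤-Reasoning

    -- Squaring avoids the root of `n`. The factor `h` bounds the product of the sizes of two small
    -- edges, and with it the number of edges joining them away from a shared vertex, by n/h.
    Small : Fin (m H) → Set
    Small e = h * (size e * size e) ≤ n

    small? : ∀ e → Dec (Small e)
    small? e = h * (size e * size e) ≤? n

    small*small : ∀ {e f} → Small e → Small f → h * (size e * size f) ≤ n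
    small*small {e} {f} small-e small-f with ≤-total (size e) (size f)
    ... | inj₁ e≤f = ≤-trans (*-monoʳ-≤ h (*-monoˡ-≤ (size f) e≤f)) small-f
    ... | inj₂ f≤e = ≤-trans (*-monoʳ-≤ h (*-monoʳ-≤ (size e) f≤e)) small-e

    -- Large edges will have colours of their own and the two parities disjoint palettes, so only
    -- intersecting small edges of equal parity have to be told apart here.
    Conflict : Fin (m H) → Fin (m H) → Set
    Conflict e f = e ≢ f × (Small e × Small f) × Meets H linear e f × parity (lev e) ≡ parity (lev f)

    conflict-sym : ∀ {e f} → Conflict e f → Conflict f e
    conflict-sym (e≢f , (small-e , small-f) , meets , par) =
      ≢-sym e≢f , (small-f , small-e) , meets-sym H linear meets , sym par

    abstract
      conflict? : ∀ e f → Dec (Conflict e f)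
      conflict? e f = ¬? (e ≟ᶠ f) ×-dec (small? e ×-dec small? f) ×-dec
        meets? H linear e f ×-dec (parity (lev e) ≟ᵇ parity (lev f))

    ProperFrom : ℕ → (Fin (m H) → Fin P) → Set
    ProperFrom i c = ∀ e f → Conflict e f → i ≤ lev e → i ≤ lev f → c e ≢ c f

    module ExtendTo (i : ℕ) (c : Fin (m H) → Fin P) (proper : ProperFrom (suc i) c) where

      Adj : Fin (m H) → Fin (m H) → Set
      Adj e f = (lev e ≡ i × lev f ≡ i) × Conflict e f

      Forbids : Fin (m H) → Fin (m H) → Set
      Forbids e f = (lev e ≡ i × suc i ≤ lev f) × Conflict e f

      Ok : Fin (m H) → Fin P → Set
      Ok e a = ∀ f → Forbids e f → c f ≢ a

      abstract
        adj? : ∀ e f → Dec (Adj e f)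
        adj? e f = ((lev e ≟ i) ×-dec (lev f ≟ i)) ×-dec conflict? e f

        forbids? : ∀ e f → Dec (Forbids e f)
        forbids? e f = ((lev e ≟ i) ×-dec (suc i ≤? lev f)) ×-dec conflict? e f

        ok? : ∀ e a → Dec (Ok e a)
        ok? e a = all? λ f → forbids? e f →-dec ¬? (c f ≟ᶠ a)

      #-none : {Q : Fin (m H) → Set} (Q? : ∀ f → Dec (Q f)) → (∀ f → ¬ Q f) → # Q? ≡ 0
      #-none Q? none = trans (∑-cong (allFin (m H)) (λ f → 𝟙-no (Q? f) (none f)))
                             (trans (∑-allFin-const (m H) 0) (*-zeroʳ (m H)))

      -- Within a group the sizes differ by less than a factor `L`: the edges counted have size at
      -- least `L ^ i`, while `e` has size below `L ^ suc i`. So `e` meets at most `2 * n * L` of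
      -- them.
      degree≤ : ∀ e → # (adj? e) ≤ R * (W R * b)
      degree≤ e with lev e ≟ i
      ... | no lev≢i = ≤-trans (≤-reflexive (#-none (adj? e) (λ f adj → lev≢i (proj₁ (proj₁ adj))))) z≤n
      ... | yes refl = ≤-trans (*-cancelˡ-≤ (L ^ i) ⦃ m^n≢0 L i ⦄ (begin
        L ^ i * # (adj? e)       ≤⟨ #-meeting H linear degree≤n (adj? e) (λ f adj → proj₁ (proj₂ (proj₂ (proj₂ adj))))
                                      (λ f adj → subst (λ j → L ^ j ≤ size f) (proj₂ (proj₁ adj)) (lev-lower f)) ⟩
        size e * (2 * n)         ≤⟨ *-monoˡ-≤ (2 * n) (<⇒≤ (lev-upper e)) ⟩
        L * L ^ i * (2 * n)      ≡⟨ shuffle L (L ^ i) (2 * n) ⟩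
        L ^ i * (2 * n * L)      ∎)) 2nL≤
        where
        open ≤-Reasoning
        shuffle : ∀ a b c → a * b * c ≡ b * (c * a)
        shuffle = solve-∀

      -- At most n/h common neighbours pass through the vertex of `e` and `f`, by the degree bound,
      -- and at most n/h others join the two edges, by smallness. The factor 2 of the statement
      -- makes this `4 * n` against `h * b`.
      common≤ : ∀ e f → Adj e f → 2 * # (λ g → adj? e g ×-dec adj? f g) ≤ b
      common≤ e f (_ , e≢f , (small-e , small-f) , _) = *-cancelˡ-≤ h (begin
        h * (2 * # both?)                       ≡⟨ rotate h (# both?) ⟩
        2 * (h * # both?)                       ≤⟨ *-monoʳ-≤ 2 (#-common H linear {h = h} e≢f hdegree≤n both? meets) ⟩
        2 * (n + h * (size e * size f))         ≤⟨ *-monoʳ-≤ 2 (+-monoʳ-≤ n (small*small small-e small-f)) ⟩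
        2 * (n + n)                             ≡⟨ four n ⟩
        4 * n                                   ≤⟨ 4n≤ ⟩
        h * b                                   ∎)
        where
        open ≤-Reasoning
        both? = λ g → adj? e g ×-dec adj? f g
        rotate : ∀ h k → h * (2 * k) ≡ 2 * (h * k)
        rotate = solve-∀
        four : ∀ n → 2 * (n + n) ≡ 4 * n
        four = solve-∀
        meets : ∀ g → Adj e g × Adj f g → Meets H linear g e × Meets H linear g f
        meets g ((_ , _ , _ , eg , _) , (_ , _ , _ , fg , _)) = meets-sym H linear eg , meets-sym H linear fg

      -- By parity, the edges that forbid colours at e have level at least i + 2.
      L*#-forbids≤ : ∀ e → L * # (forbids? e) ≤ 2 * n
      L*#-forbids≤ e with lev e ≟ i
      ... | no lev≢i = ≤-trans (≤-reflexive (trans (cong (L *_) (#-none (forbids? e) (λ f fb → lev≢i (proj₁ (proj₁ fb))))) (*-zeroʳ L))) z≤n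
      ... | yes refl = *-cancelˡ-≤ (L ^ suc i) ⦃ m^n≢0 L (suc i) ⦄ (begin
        L ^ suc i * (L * # (forbids? e))     ≡⟨ shuffle (L ^ suc i) L (# (forbids? e)) ⟩
        L ^ suc (suc i) * # (forbids? e)     ≤⟨ #-meeting H linear degree≤n (forbids? e) (λ f fb → proj₁ (proj₂ (proj₂ (proj₂ fb)))) far ⟩
        size e * (2 * n)                     ≤⟨ *-monoˡ-≤ (2 * n) (<⇒≤ (lev-upper e)) ⟩
        L ^ suc i * (2 * n)                  ∎)
        where
        open ≤-Reasoning
        shuffle : ∀ a b c → a * (b * c) ≡ b * a * c
        shuffle = solve-∀
        far : ∀ f → Forbids e f → L ^ suc (suc i) ≤ size f
        far f ((_ , i<) , _ , _ , _ , par) = ≤-trans (^-monoʳ-≤ L (parity-gap par i<)) (lev-lower f)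

      lists≥ : ∀ e → W R * b ≤ # (ok? e)
      lists≥ e = +-cancelʳ-≤ F (W R * b) _ (begin
        W R * b + F                       ≤⟨ room F (L*#-forbids≤ e) ⟩
        P                                 ≡⟨ trans (∑-allFin-const P 1) (*-identityʳ P) ⟨
        ∑ (allFin P) (λ _ → 1)            ≤⟨ ∑-mono (allFin P) one ⟩
        ∑ (allFin P) (λ a → 𝟙 (ok? e a) + used a)
                                          ≡⟨ trans (∑-+ (allFin P) _ _) (cong (# (ok? e) +_) (#-image (forbids? e) c)) ⟩
        # (ok? e) + F                     ∎)
        where
        open ≤-Reasoning
        F = # (forbids? e)
        used : Fin P → ℕ
        used a = ∑ (allFin (m H)) (λ f → 𝟙 (forbids? e f) * 𝟙 (c f ≟ᶠ a))
        clash : ∀ a → ¬ Ok e a → 1 ≤ used a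
        clash a ¬ok with ¬∀⟶∃¬ (m H) _ (λ f → forbids? e f →-dec ¬? (c f ≟ᶠ a)) ¬ok
        ... | f , ¬free with forbids? e f
        ... | no ¬fb = contradiction (λ fb → contradiction fb ¬fb) ¬free
        ... | yes fb with c f ≟ᶠ a
        ... | no neq = contradiction (λ _ → neq) ¬free
        ... | yes eq = ≤-trans (≤-reflexive (sym (cong₂ _*_ (𝟙-yes (forbids? e f) fb) (𝟙-yes (c f ≟ᶠ a) eq))))
          (∑-member (λ f → 𝟙 (forbids? e f) * 𝟙 (c f ≟ᶠ a)) (∈-allFin f))
        one : ∀ a → 1 ≤ 𝟙 (ok? e a) + used a
        one a with ok? e a
        ... | yes _  = s≤s z≤n
        ... | no ¬ok = clash a ¬ok

      extend : ∃ (ProperFrom i)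
      extend = merge (list-colouring adj? (λ e adj → proj₁ (proj₂ adj) refl)
          (λ { e f ((ei , fi) , cf) → (fi , ei) , conflict-sym cf }) ok? R b degree≤ common≤ lists≥ 16≤b)
        where
        merge : (∃ λ (σ : Fin (m H) → Fin P) → (∀ e → Ok e (σ e)) × (∀ e f → Adj e f → σ e ≢ σ f)) → ∃ (ProperFrom i)
        merge (σ , ok , σ-proper) = c′ , proper′
          where
          c′ : Fin (m H) → Fin P
          c′ e with lev e ≟ i
          ... | yes _ = σ e
          ... | no _  = c e
          proper′ : ProperFrom i c′
          proper′ e f cf i≤e i≤f with lev e ≟ i | lev f ≟ i
          ... | yes e≡i | yes f≡i = σ-proper e f ((e≡i , f≡i) , cf)
          ... | yes e≡i | no f≢i  = ≢-sym (ok e f ((e≡i , ≤∧≢⇒< i≤f (≢-sym f≢i)) , cf))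
          ... | no e≢i  | yes f≡i = ok f e ((f≡i , ≤∧≢⇒< i≤e (≢-sym e≢i)) , conflict-sym cf)
          ... | no e≢i  | no f≢i  = proper e f cf (≤∧≢⇒< i≤e (≢-sym e≢i)) (≤∧≢⇒< i≤f (≢-sym f≢i))

    small-colouring : ∃ λ (c : Fin (m H) → Fin P) → ∀ e f → Conflict e f → c e ≢ c f
    small-colouring = finish (descend n 0 refl)
      where
      descend : ∀ j i → i + j ≡ n → ∃ (ProperFrom i)
      -- Here `i = n`, and all levels are below `n`, so a constant colouring is vacuously proper.
      descend zero    i eq = (λ _ → fromℕ< (n≢0⇒n>0 (≢-nonZero⁻¹ P))) ,
        λ e f _ i≤e → contradiction (lev<n e) (≤⇒≯ (≤-trans (≤-reflexive (trans (sym eq) (+-identityʳ i))) i≤e))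
      descend (suc j) i eq with descend j (suc i) (trans (sym (+-suc i j)) eq)
      ... | c , proper = ExtendTo.extend i c proper
      finish : ∃ (ProperFrom 0) → ∃ λ (c : Fin (m H) → Fin P) → ∀ e f → Conflict e f → c e ≢ c f
      finish (c , proper) = c , λ e f cf → proper e f cf z≤n z≤n

-- Choice of the constants and union of the palettes.

module Assembly where
  open import Data.Nat using (ℕ; suc; _+_; _*_; _≤_; _<_; z≤n; s≤s; NonZero; ≢-nonZero⁻¹; >-nonZero)
  open import Data.Nat.Properties
  open import Data.Nat.DivMod using (/-monoˡ-≤; m*n/n≡m)
  open import Data.Nat.Tactic.RingSolver using (solve-∀)
  open import Data.Fin using (Fin; join; splitAt)
  open import Data.Fin.Properties using (splitAt-join)
  open import Data.List using (List; length; allFin; filter)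
  open import Data.List.Membership.Propositional using (_∈_)
  open import Data.List.Membership.Propositional.Properties using (∈-allFin; ∈-filter⁺)
  open import Data.List.Membership.Setoid.Properties using (index-injective)
  open import Data.List.Relation.Unary.Any using (index)
  open import Data.Bool using (Bool; true; false)
  open import Data.Product using (_×_; _,_; ∃)
  open import Data.Sum using (_⊎_; inj₁; inj₂)
  open import Data.Sum.Properties using (inj₁-injective; inj₂-injective)
  open import Relation.Nullary using (Dec; yes; no; ¬_)
  open import Relation.Nullary.Decidable using (¬?)
  open import Relation.Binary.PropositionalEquality hiding ([_])
  open Sums
  open LocallySparse using (W)
  open Linearity
  open Levels

  ≤-÷ : ∀ {k x N} → 0 < x → k * x ≤ N → k ≤ N ÷ x
  ≤-÷ {k} {suc x} _ kx≤N = ≤-trans (≤-reflexive (sym (m*n/n≡m k (suc x)))) (/-monoˡ-≤ (suc x) kx≤N)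

  W-positive : ∀ R .{{_ : NonZero R}} → 0 < W R
  W-positive R = *-mono-< (*-mono-< (s≤s (z≤n {7})) (n≢0⇒n>0 (≢-nonZero⁻¹ R))) (m^n>0 2 (suc (LocallySparse.κ R)))

  coloursPair : ∀ {P} → Bool → Fin P → Fin P ⊎ Fin P
  coloursPair false = inj₁
  coloursPair true  = inj₂

  coloursPair-injective : ∀ {P} s t {a b : Fin P} → coloursPair s a ≡ coloursPair t b → s ≡ t × a ≡ b
  coloursPair-injective false false eq = refl , inj₁-injective eq
  coloursPair-injective true  true  eq = refl , inj₂-injective eq

  join-injective : ∀ a b {i j} → join a b i ≡ join a b j → i ≡ j
  join-injective a b {i} {j} eq = trans (sym (splitAt-join a b i)) (trans (cong (splitAt a) eq) (splitAt-join a b j))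

  module Constants (E : ℕ) .{{_ : NonZero E}} where

    abstract
      -- The target is n/E colours, with palettes of size `n ÷ (4 * E)` and `b = n ÷ x`. `L` keeps
      -- the forbidden colours below half of the n/(8E) colours that a palette has after rounding,
      -- or equal to it. As `x = s * W R`, the lists `W R * b` have size at most n/s, and the degree
      -- `2 * n * L`, which is `s * n`, is at most `R` times this list size; the 2 in `R` pays for
      -- the rounding in `b`. Finally `h = 8 * x` yields `4 * n ≤ h * b`, and 1/h becomes the
      -- density bound of the theorem.
      s L R x h : ℕ
      s = 8 * (8 * E)
      L = 4 * (8 * E)
      R = 2 * (s * s)
      x = s * W R
      h = 8 * x

      s≢0 : NonZero s
      s≢0 = m*n≢0 8 (8 * E) ⦃ _ ⦄ ⦃ m*n≢0 8 E ⦄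

      R≢0 : NonZero R
      R≢0 = m*n≢0 2 (s * s) ⦃ _ ⦄ ⦃ m*n≢0 s s ⦃ s≢0 ⦄ ⦃ s≢0 ⦄ ⦄

      0<x : 0 < x
      0<x = *-mono-< (n≢0⇒n>0 (≢-nonZero⁻¹ s ⦃ s≢0 ⦄)) (W-positive R ⦃ R≢0 ⦄)

      h≢0 : NonZero h
      h≢0 = m*n≢0 8 x ⦃ _ ⦄ ⦃ >-nonZero 0<x ⦄

      2≤L : 2 ≤ L
      2≤L = ≤-trans (s≤s (s≤s (z≤n {2}))) (m≤m*n 4 (8 * E) ⦃ m*n≢0 8 E ⦄)

      4E≤x : 4 * E ≤ x
      4E≤x = begin
        4 * E          ≤⟨ *-mono-≤ {4} {8} (s≤s (s≤s (s≤s (s≤s z≤n)))) (m≤n*m E 8) ⟩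
        s              ≡⟨ *-identityʳ s ⟨
        s * 1          ≤⟨ *-monoʳ-≤ s (W-positive R ⦃ R≢0 ⦄) ⟩
        x              ∎
        where open ≤-Reasoning

      4E≤h² : 4 * E ≤ h * h
      4E≤h² = begin
        4 * E       ≤⟨ 4E≤x ⟩
        x           ≤⟨ m≤n*m x 8 ⟩
        h           ≤⟨ m≤m*n h h ⦃ h≢0 ⦄ ⟩
        h * h       ∎
        where open ≤-Reasoning

      2nL≤ : ∀ {n b} → n ≤ 2 * (x * b) → 2 * n * L ≤ R * (W R * b)
      2nL≤ {n} {b} n≤2xb = begin
        2 * n * L                  ≡⟨ left n (8 * E) ⟩
        s * n                      ≤⟨ *-monoʳ-≤ s n≤2xb ⟩
        s * (2 * (x * b))          ≡⟨ right s (W R) b ⟩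
        R * (W R * b)              ∎
        where
        open ≤-Reasoning
        left : ∀ n e → 2 * n * (4 * e) ≡ 8 * e * n
        left = solve-∀
        right : ∀ s w b → s * (2 * (s * w * b)) ≡ 2 * (s * s) * (w * b)
        right = solve-∀

      4n≤hb : ∀ {n b} → n ≤ 2 * (x * b) → 4 * n ≤ h * b
      4n≤hb {n} {b} n≤2xb = ≤-trans (*-monoʳ-≤ 4 n≤2xb) (≤-reflexive (eight x b))
        where
        eight : ∀ x b → 4 * (2 * (x * b)) ≡ 8 * x * b
        eight = solve-∀

      -- In units of n/s, the list takes at most 1 and the forbidden colours at most 4, while the
      -- palette has at least 8.
      room-left : ∀ {n b P F} → x * b ≤ n → n ≤ 2 * (4 * E * P) → L * F ≤ 2 * n → W R * b + F ≤ P
      room-left {n} {b} {P} {F} xb≤n n≤8EP LF≤ = *-cancelˡ-≤ s ⦃ s≢0 ⦄ (begin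
        s * (W R * b + F)                ≡⟨ expand (8 * E) (W R) b F ⟩
        x * b + 2 * (L * F)              ≤⟨ +-mono-≤ xb≤n (*-monoʳ-≤ 2 LF≤) ⟩
        n + 2 * (2 * n)                  ≤⟨ m≤m+n _ (3 * n) ⟩
        n + 2 * (2 * n) + 3 * n          ≡⟨ eight n ⟩
        8 * n                            ≤⟨ *-monoʳ-≤ 8 n≤8EP ⟩
        8 * (2 * (4 * E * P))            ≡⟨ cong (8 *_) (regroup E P) ⟩
        8 * (8 * E * P)                  ≡⟨ *-assoc 8 (8 * E) P ⟨
        s * P                            ∎)
        where
        open ≤-Reasoning
        expand : ∀ e w b F → 8 * e * (w * b + F) ≡ 8 * e * w * b + 2 * (4 * e * F)
        expand = solve-∀
        eight : ∀ n → n + 2 * (2 * n) + 3 * n ≡ 8 * n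
        eight = solve-∀
        regroup : ∀ E P → 2 * (4 * E * P) ≡ 8 * E * P
        regroup = solve-∀

    instance
      R-nonZero : NonZero R
      R-nonZero = R≢0
      h-nonZero : NonZero h
      h-nonZero = h≢0

    module _ {n : ℕ} (n≥n₀ : 16 * x ≤ n) (H : Hypergraph n) (linear : Linear H)
      (hdegree≤n : ∀ v → h * degree H v ≤ n)
      (gap : ∀ e → ¬ (h * h * (edgeSize H e * edgeSize H e) ≤ n) → h * h * n ≤ edgeSize H e * edgeSize H e)
      where

      private
        P b : ℕ
        P = n ÷ (4 * E)
        b = n ÷ x

        x≤n : x ≤ n
        x≤n = ≤-trans (m≤n*m x 16) n≥n₀

        n≤2xb : n ≤ 2 * (x * b)
        n≤2xb = ≤-2*-÷ 0<x x≤n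

        n≤8EP : n ≤ 2 * (4 * E * P)
        n≤8EP = ≤-2*-÷ (n≢0⇒n>0 (≢-nonZero⁻¹ (4 * E) ⦃ m*n≢0 4 E ⦄)) (≤-trans 4E≤x x≤n)

        0<n : 0 < n
        0<n = <-≤-trans 0<x x≤n

        instance
          n≢0 : NonZero n
          n≢0 = >-nonZero 0<n
          P≢0 : NonZero P
          P≢0 = >-nonZero (≤-÷ (n≢0⇒n>0 (≢-nonZero⁻¹ (4 * E) ⦃ m*n≢0 4 E ⦄))
                               (≤-trans (≤-reflexive (*-identityˡ (4 * E))) (≤-trans 4E≤x x≤n)))

        room : ∀ F → L * F ≤ 2 * n → W R * b + F ≤ P
        room F = room-left (*-÷-≤ n x) n≤8EP

        degree≤n : ∀ v → degree H v ≤ n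
        degree≤n v = ≤-trans (m≤n*m (degree H v) h) (hdegree≤n v)

        SmallEdge : Fin (m H) → Set
        SmallEdge = Small H linear {P} L R b h 2≤L (≤-÷ 0<x n≥n₀) hdegree≤n (2nL≤ n≤2xb) (4n≤hb n≤2xb) room

        smallEdge? : ∀ e → Dec (SmallEdge e)
        smallEdge? = small? H linear {P} L R b h 2≤L (≤-÷ 0<x n≥n₀) hdegree≤n (2nL≤ n≤2xb) (4n≤hb n≤2xb) room

        levelOf : Fin (m H) → ℕ
        levelOf = lev H linear {P} L R b h 2≤L (≤-÷ 0<x n≥n₀) hdegree≤n (2nL≤ n≤2xb) (4n≤hb n≤2xb) room

        Large? : ∀ e → Dec (¬ SmallEdge e)
        Large? e = ¬? (smallEdge? e)

        larges : List (Fin (m H))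
        larges = filter Large? (allFin (m H))

        T : ℕ
        T = length larges

        large∈ : ∀ e → ¬ SmallEdge e → e ∈ larges
        large∈ e large = ∈-filter⁺ Large? (∈-allFin e) large

        -- `Small` has the factor `h` where `gap` has `h * h`, so an edge that is not small lies
        -- above the lower end of the gap, hence beyond its upper end.
        large-size : ∀ e → ¬ SmallEdge e → h * h * n ≤ edgeSize H e * edgeSize H e
        large-size e ¬small = gap e (λ le → ¬small (≤-trans (*-monoˡ-≤ _ (m≤m*n h h)) le))

        4ET≤ : 4 * E * T ≤ 2 * n
        4ET≤ = begin
          4 * E * T                      ≤⟨ *-monoˡ-≤ T 4E≤h² ⟩
          h * h * T                      ≡⟨ cong (h * h *_) (length-filter Large? (allFin (m H))) ⟩
          h * h * # Large?               ≤⟨ #-large H linear degree≤n {k = h * h} Large? large-size ⟩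
          2 * n                          ∎
          where open ≤-Reasoning

      few-colours : ∃ λ k → k * E ≤ n × ∃ λ (c : Fin (m H) → Fin k) → IsProperEdgeColouring H k c
      few-colours = assemble (small-colouring H linear {P} L R b h 2≤L (≤-÷ 0<x n≥n₀) hdegree≤n (2nL≤ n≤2xb) (4n≤hb n≤2xb) room)
        where
        open ≤-Reasoning
        -- The large edges take at most n/(2E) colours and each of the two palettes at most n/(4E).
        count : (T + (P + P)) * E ≤ n
        count = *-cancelˡ-≤ 4 (begin
          4 * ((T + (P + P)) * E)              ≡⟨ expand T P E ⟩
          4 * E * T + 2 * (4 * E * P)          ≤⟨ +-mono-≤ 4ET≤ (*-monoʳ-≤ 2 (*-÷-≤ n (4 * E))) ⟩
          2 * n + 2 * n                        ≡⟨ four n ⟩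
          4 * n                                ∎)
          where
          expand : ∀ t p E → 4 * ((t + (p + p)) * E) ≡ 4 * E * t + 2 * (4 * E * p)
          expand = solve-∀
          four : ∀ n → 2 * n + 2 * n ≡ 4 * n
          four = solve-∀
        assemble : (∃ λ (c : Fin (m H) → Fin P) → ∀ e f → Conflict H linear {P} L R b h 2≤L (≤-÷ 0<x n≥n₀) hdegree≤n (2nL≤ n≤2xb) (4n≤hb n≤2xb) room e f → c e ≢ c f) →
          ∃ λ k → k * E ≤ n × ∃ λ (c : Fin (m H) → Fin k) → IsProperEdgeColouring H k c
        assemble (c , c-proper) = T + (P + P) , count , (λ e → join T (P + P) (colour e (smallEdge? e))) ,
          λ e f e≢f meets eq → distinct e f e≢f meets (smallEdge? e) (smallEdge? f) (join-injective T (P + P) eq)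
          where
          colour : ∀ e → Dec (SmallEdge e) → Fin T ⊎ Fin (P + P)
          colour e (yes _)    = inj₂ (join P P (coloursPair (parity (levelOf e)) (c e)))
          colour e (no large) = inj₁ (index (large∈ e large))
          distinct : ∀ e f → e ≢ f → Meets H linear e f → (e? : Dec (SmallEdge e)) (f? : Dec (SmallEdge f)) →
            colour e e? ≢ colour f f?
          distinct e f e≢f meets (yes small-e) (yes small-f) eq
            with coloursPair-injective (parity (levelOf e)) (parity (levelOf f)) (join-injective P P (inj₂-injective eq))
          ... | same-parity , same-colour = c-proper e f (e≢f , (small-e , small-f) , meets , same-parity) same-colour
          distinct e f e≢f meets (no large-e) (no large-f) eq =
            e≢f (index-injective (setoid _) (large∈ e large-e) (large∈ f large-f) (inj₁-injective eq))

-- Rationals with explicit numerator and denominator.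

module Fractions where
  open import Data.Nat as ℕ using (ℕ; suc)
  import Data.Nat.Properties as ℕ
  open import Data.Integer as ℤ using (+_)
  import Data.Integer.Properties as ℤ
  open import Data.Rational using (ℚ; mkℚ; _/_; toℚᵘ; 0ℚ; _*_; _≤_; _<_; *<*)
  open import Data.Rational.Properties using (toℚᵘ-fromℚᵘ; toℚᵘ-homo-*; toℚᵘ-mono-≤; toℚᵘ-cancel-≤; toℚᵘ-cancel-<)
  open import Data.Rational.Unnormalised as ℚᵘ using (ℚᵘ; mkℚᵘ; *≤*; *<*)
  import Data.Rational.Unnormalised.Properties as ℚᵘ
  open import Data.Product using (∃; _,_)
  open import Relation.Binary.PropositionalEquality

  -- Elements of `ℚ` are in lowest terms, but products produce unreduced fractions. Comparison among
  -- unnormalised rationals avoids all common divisors.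
  _≈_/suc_ : ℚ → ℕ → ℕ → Set
  x ≈ a /suc d = toℚᵘ x ℚᵘ.≃ mkℚᵘ (+ a) d

  ≈-ℕ : ∀ n → ℕtoℚ n ≈ n /suc 0
  ≈-ℕ n = toℚᵘ-fromℚᵘ (mkℚᵘ (+ n) 0)

  ≈-unit : ∀ d → ((+ 1) / suc d) ≈ 1 /suc d
  ≈-unit d = toℚᵘ-fromℚᵘ (mkℚᵘ (+ 1) d)

  ≈-* : ∀ {x y a b d e} → x ≈ a /suc d → y ≈ b /suc e → (x * y) ≈ (a ℕ.* b) /suc (e ℕ.+ d ℕ.* suc e)
  ≈-* {x} {y} {a} {b} {d} {e} x≈ y≈ = ℚᵘ.≃-trans (toℚᵘ-homo-* x y) (ℚᵘ.≃-trans (ℚᵘ.*-cong x≈ y≈)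
    (ℚᵘ.≃-reflexive (cong (λ i → mkℚᵘ i (e ℕ.+ d ℕ.* suc e)) (sym (ℤ.pos-* a b)))))

  module _ {x y : ℚ} {a b d e : ℕ} (x≈ : x ≈ a /suc d) (y≈ : y ≈ b /suc e) where

    cross-≤⁻ : x ≤ y → a ℕ.* suc e ℕ.≤ b ℕ.* suc d
    cross-≤⁻ x≤y with ℚᵘ.≤-respʳ-≃ y≈ (ℚᵘ.≤-respˡ-≃ x≈ (toℚᵘ-mono-≤ x≤y))
    ... | *≤* le = ℤ.drop‿+≤+ (subst₂ ℤ._≤_ (sym (ℤ.pos-* a (suc e))) (sym (ℤ.pos-* b (suc d))) le)

    cross-≤⁺ : a ℕ.* suc e ℕ.≤ b ℕ.* suc d → x ≤ y
    cross-≤⁺ le = toℚᵘ-cancel-≤ (ℚᵘ.≤-respʳ-≃ (ℚᵘ.≃-sym y≈) (ℚᵘ.≤-respˡ-≃ (ℚᵘ.≃-sym x≈)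
      (*≤* (subst₂ ℤ._≤_ (ℤ.pos-* a (suc e)) (ℤ.pos-* b (suc d)) (ℤ.+≤+ le)))))

    cross-<⁺ : a ℕ.* suc e ℕ.< b ℕ.* suc d → x < y
    cross-<⁺ lt = toℚᵘ-cancel-< (ℚᵘ.<-respʳ-≃ (ℚᵘ.≃-sym y≈) (ℚᵘ.<-respˡ-≃ (ℚᵘ.≃-sym x≈)
      (ℚᵘ.*<* (subst₂ ℤ._<_ (ℤ.pos-* a (suc e)) (ℤ.pos-* b (suc d)) (ℤ.+<+ lt)))))

  positive-fraction : ∀ ε → 0ℚ < ε → ∃ λ p → ∃ λ d → ε ≈ suc p /suc d
  positive-fraction (mkℚ (+ suc p) d _) _ = p , d , ℚᵘ.≃-refl
  positive-fraction (mkℚ (+ 0) d _) (*<* (ℤ.+<+ ()))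
  positive-fraction (mkℚ (ℤ.-[1+ _ ]) d _) (*<* ())

-- From the rational hypotheses to inequalities of natural numbers.

module Translation where
  open import Data.Nat as ℕ using (ℕ; suc)
  open import Data.Nat.Properties
  open import Data.Nat.Tactic.RingSolver using (solve-∀)
  open import Data.Integer using (+_)
  open import Data.Rational using (ℚ; _/_; 0ℚ; _*_; _≤_; _<_)
  open import Data.Rational.Unnormalised.Properties using (≃-refl)
  open import Data.Product using (_×_; _,_)
  open import Relation.Nullary using (¬_)
  open import Relation.Binary.PropositionalEquality
  open Fractions

  module _ (g : ℕ) where

    η : ℚ
    η = (+ 1) / suc g

    η-positive : 0ℚ < η
    η-positive = cross-<⁺ {a = 0} {d = 0} ≃-refl (≈-unit g) (ℕ.s≤s ℕ.z≤n)

    private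
      η² : (η * η) ≈ 1 ℕ.* 1 /suc (g ℕ.+ g ℕ.* suc g)
      η² = ≈-* {η} {η} {1} {1} (≈-unit g) (≈-unit g)

    degree-bound : ∀ {a n} → ℕtoℚ a ≤ η * ℕtoℚ n → suc g ℕ.* a ℕ.≤ n
    degree-bound {a} {n} le = subst₂ ℕ._≤_ (left g a) (right n)
      (cross-≤⁻ (≈-ℕ a) (≈-* {η} {ℕtoℚ n} {1} {n} (≈-unit g) (≈-ℕ n)) le)
      where
      left : ∀ g a → a ℕ.* (1 ℕ.+ g ℕ.* 1) ≡ (1 ℕ.+ g) ℕ.* a
      left = solve-∀
      right : ∀ n → 1 ℕ.* n ℕ.* 1 ≡ n
      right = solve-∀

    -- The excluded range of sizes is stated with squares, so no root occurs. With h for `suc g`,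
    -- clearing denominators turns its two ends into n < h²s² and s² < h²n; if the first holds, the
    -- second must fail.
    size-gap : ∀ {s n} →
      ¬ ((η * η * ℕtoℚ n < ℕtoℚ s * ℕtoℚ s) × (ℕtoℚ s * ℕtoℚ s * (η * η) < ℕtoℚ n)) →
      ¬ (suc g ℕ.* suc g ℕ.* (s ℕ.* s) ℕ.≤ n) → suc g ℕ.* suc g ℕ.* n ℕ.≤ s ℕ.* s
    size-gap {s} {n} gap ¬small = ≮⇒≥ λ s²<h²n → gap
      ( cross-<⁺ (≈-* {η * η} {ℕtoℚ n} {1 ℕ.* 1} {n} η² (≈-ℕ n)) (≈-* {ℕtoℚ s} {ℕtoℚ s} {s} {s} (≈-ℕ s) (≈-ℕ s))
          (subst₂ ℕ._<_ (lower n) (upper g (s ℕ.* s)) (≰⇒> ¬small))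
      , cross-<⁺ (≈-* {ℕtoℚ s * ℕtoℚ s} {η * η} {s ℕ.* s} {1 ℕ.* 1} (≈-* {ℕtoℚ s} {ℕtoℚ s} {s} {s} (≈-ℕ s) (≈-ℕ s)) η²) (≈-ℕ n)
          (subst₂ ℕ._<_ (lower′ (s ℕ.* s)) (upper′ g n) s²<h²n))
      where
      lower : ∀ n → n ≡ 1 ℕ.* n ℕ.* 1
      lower = solve-∀
      upper : ∀ g q → (1 ℕ.+ g) ℕ.* (1 ℕ.+ g) ℕ.* q ≡ q ℕ.* (1 ℕ.+ (g ℕ.+ g ℕ.* (1 ℕ.+ g)) ℕ.* 1)
      upper = solve-∀
      lower′ : ∀ q → q ≡ q ℕ.* 1 ℕ.* 1
      lower′ = solve-∀
      upper′ : ∀ g n → (1 ℕ.+ g) ℕ.* (1 ℕ.+ g) ℕ.* n ≡ n ℕ.* (1 ℕ.+ (g ℕ.+ g ℕ.* (1 ℕ.+ g) ℕ.+ 0))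
      upper′ = solve-∀

  -- The numerator of `ε` is at least 1, so `ε` is at least 1 / (d + 1), the fraction of `n` that
  -- `k` respects.
  colour-bound : ∀ {ε p d k n} → ε ≈ suc p /suc d → k ℕ.* suc d ℕ.≤ n → ℕtoℚ k ≤ ε * ℕtoℚ n
  colour-bound {ε} {p} {d} {k} {n} ε≈ le = cross-≤⁺ (≈-ℕ k) (≈-* {ε} {ℕtoℚ n} {suc p} {n} ε≈ (≈-ℕ n)) (begin
    k ℕ.* (1 ℕ.+ d ℕ.* 1)       ≡⟨ cong (λ i → k ℕ.* suc i) (*-identityʳ d) ⟩
    k ℕ.* suc d                 ≤⟨ le ⟩
    n                           ≤⟨ m≤n*m n (suc p) ⟩
    suc p ℕ.* n                 ≡⟨ *-identityʳ (suc p ℕ.* n) ⟨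
    suc p ℕ.* n ℕ.* 1           ∎)
    where open ≤-Reasoning

open import Data.Nat using (ℕ; _≥_)
open import Data.Rational using (ℚ; 0ℚ; _*_; _≤_; _<_)
open import Data.Fin using (Fin)
open import Data.Product using (_×_; ∃; _,_)
open import Relation.Nullary using (¬_)
open import Relation.Binary.PropositionalEquality using (_≡_; subst)
open import Data.Nat.Properties using (suc-pred)

theorem1p3 : (ε : ℚ) → 0ℚ < ε →
    ∃ λ (n₀ : ℕ) → ∃ λ (η : ℚ) → (0ℚ < η) ×
    (∀ (n : ℕ) → n ≥ n₀ → (H : Hypergraph n) → Linear H →
    (∀ (v : Fin n) → ℕtoℚ (degree H v) ≤ η * ℕtoℚ n) →
    (∀ (i : Fin (m H)) →
    ¬ ((η * η * ℕtoℚ n < ℕtoℚ (edgeSize H i) * ℕtoℚ (edgeSize H i)) ×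
    (ℕtoℚ (edgeSize H i) * ℕtoℚ (edgeSize H i) * (η * η) < ℕtoℚ n))) →
    ChromaticIndex≤ H (ε * ℕtoℚ n))
theorem1p3 ε 0<ε with Fractions.positive-fraction ε 0<ε
-- From `16 * x ≤ n` follows `16 ≤ n ÷ x`, the lower bound for `b` that list colouring asks for. The
-- denominator of `η` is `C.h`, written as the successor of `g`.
... | p , d , ε≈ = 16 ℕ.* C.x , T.η g , T.η-positive g , λ n n≥n₀ H linear degree≤ gap →
  let k , kE≤n , colouring = C.few-colours n≥n₀ H linear
        (λ v → subst (λ h → h ℕ.* degree H v ℕ.≤ n) g≡ (T.degree-bound g {degree H v} {n} (degree≤ v)))
        (λ e → subst (λ h → ¬ (h ℕ.* h ℕ.* (edgeSize H e ℕ.* edgeSize H e) ℕ.≤ n) →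
                            h ℕ.* h ℕ.* n ℕ.≤ edgeSize H e ℕ.* edgeSize H e) g≡ (T.size-gap g {edgeSize H e} {n} (gap e)))
  in k , T.colour-bound {ε} {p} {d} {k} {n} ε≈ kE≤n , colouring
  where
  import Data.Nat as ℕ
  module C = Assembly.Constants (ℕ.suc d)
  module T = Translation
  g : ℕ
  g = ℕ.pred C.h
  g≡ : ℕ.suc g ≡ C.h
  g≡ = suc-pred C.h ⦃ C.h≢0 ⦄
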